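{- The doctrine $\mathrm{Ssb}_{\mathbf{Asm}}:\mathbf{Asm}^{op}\to\mathbf{InfSL}$ of strong subobjects on $\mathbf{Asm}$ is (equivalent to) the elementary quotient completion $\overline{\mathbb P\Gamma}:\mathcal Q_{\mathbb P\Gamma}^{op}\to\mathbf{InfSL}$ of the doctrine $\mathbb P\Gamma:\mathbf{PAsm}^{op}\to\mathbf{InfSL}$; in particular $\mathcal Q_{\mathbb P\Gamma}\simeq\mathbf{Asm}$.
   Context: Write $\varphi_e$ for the $e$-th partial recursive function. An assembly is a pair $(P,T)$ with $P$ a set and $T\subseteq P\times\mathbb N$ a total relation (every $x\in P$ has some $n$ with $x\,T\,n$). A morphism $f:(P,T)\to(P',T')$ is a function $f:P\to P'$ for which some $t\in\mathbb N$ tracks $f$: whenever $x\,T\,n$, $\varphi_t(n)$ is defined and $f(x)\,T'\,\varphi_t(n)$. These form the category $\mathbf{Asm}$. An assembly is partitioned if $T$ is a function $P\to\mathbb N$; $\mathbf{PAsm}$ is the full subcategory of partitioned assemblies. A strong subobject of $(P,T)$ in $\mathbf{Asm}$ is (up to iso) an inclusion $(X,T\cap(X\times\mathbb N))\hookrightarrow(P,T)$ for a subset $X\subseteq P$; $\mathrm{Ssb}_{\mathbf{Asm}}$ sends an assembly to its poset of strong subobjects, reindexing by pullback. $\mathbb P\Gamma:\mathbf{PAsm}^{op}\to\mathbf{InfSL}$ sends $(P,T)$ to the powerset of $P$ and an arrow $f$ to inverse image along $f$; its equality predicate on $A$ is the diagonal subset. Elementary doctrines: for $\mathcal C$ with finite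 products, an elementary doctrine is a functor $P:\mathcal C^{op}\to\mathbf{InfSL}$ (write $P_f$ for $P(f)$) such that for every object $A$ there is $\delta_A\in P(A\times A)$ with the property that for every $X$ the map $\alpha\mapsto P_{\langle pr_1,pr_2\rangle}(\alpha)\wedge P_{\langle pr_2,pr_3\rangle}(\delta_A)$, $P(X\times A)\to P(X\times A\times A)$, is left adjoint to $P_{\langle pr_1,pr_2,pr_2\rangle}$. We write $a:A\mid\phi\vdash\psi$ for $\phi\le\psi$ in $P(A)$ and $a=_Aa'$ for $\delta_A$. A $P$-equivalence relation on $A$ is $\rho\in P(A\times A)$ that is reflexive ($a=_Aa'\vdash\rho(a,a')$), symmetric and transitive. The elementary quotient completion $\overline P:\mathcal Q_P^{op}\to\mathbf{InfSL}$ has as objects pairs $(A,\rho)$ with $\rho$ a $P$-equivalence relation on $A$; an arrow $(A,\rho)\to(B,\sigma)$ is an equivalence class of arrows $f:A\to B$ of $\mathcal C$ with $\rho(a,a')\vdash\sigma(f(a),f(a'))$, where $f\sim g$ iff $\rho(a,a')\vdash\sigma(f(a),g(a'))$; composition is on representatives; $\overline P(A,\rho)$ is the sub-poset of $P(A)$ of those $\alpha$ with $\alpha(a)\wedge\rho(a,a')\vdash\alpha(a')$, with reindexing as in $P$. -}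

module Defs where

open import Level using (Level; _⊔_; Lift; lift) renaming (suc to lsuc)
open import Data.Fin using (Fin; zero; suc; toℕ; fromℕ<)
open import Data.Fin.Properties using (toℕ<n; fromℕ<-toℕ)
open import Data.Nat using (ℕ; zero; suc; _+_; _*_; _∸_; _≤_; _<_; z≤n; s≤s; _≤?_; _<?_)
open import Data.Nat.Properties using (≤-refl; ≤-trans; ≤-reflexive; ≤-antisym; ≤-pred; <-cmp; ≤-<-trans; <-≤-trans; <-irrefl; ≰⇒>; n≤1+n; m≤m+n; m≤n+m; m≤m*n; m≤n⇒m≤1+n; +-comm; +-mono-<-≤; *-mono-≤; *-mono-<; *-monoʳ-≤; m+n∸m≡n; m≤n⇒m∸n≡0; m<n⇒0<n∸m; pred[m∸n]≡m∸[1+n])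
open import Data.Product using (Σ; ∃; _×_; _,_; proj₁; proj₂; swap)
open import Data.Unit.Polymorphic using (⊤; tt)
open import Data.Vec using (Vec; []; _∷_; lookup)
open import Function using (Func; _⟨$⟩_; _⇔_; mk⇔)
open import Function.Construct.Identity using () renaming (function to idFunc)
open import Function.Construct.Composition using () renaming (function to compFunc)
open import Relation.Binary using (Setoid; IsEquivalence; Rel; tri<; tri≈; tri>)
open import Relation.Binary.Lattice using (BoundedMeetSemilattice)
open import Relation.Binary.PropositionalEquality using (_≡_; refl; sym; trans; cong; cong₂; subst)
open import Relation.Nullary using (yes; no; contradiction)

record Category (o h e : Level) : Set (lsuc (o ⊔ h ⊔ e)) where
  infix  4 _≈_ _⇒_
  infixr 9 _∘_
  field
    Obj       : Set o
    _⇒_       : Obj → Obj → Set h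
    _≈_       : ∀ {A B} → Rel (A ⇒ B) e
    id        : ∀ {A} → A ⇒ A
    _∘_       : ∀ {A B C} → B ⇒ C → A ⇒ B → A ⇒ C
    assoc     : ∀ {A B C D} {f : A ⇒ B} {g : B ⇒ C} {h : C ⇒ D} → (h ∘ g) ∘ f ≈ h ∘ (g ∘ f)
    identityˡ : ∀ {A B} {f : A ⇒ B} → id ∘ f ≈ f
    identityʳ : ∀ {A B} {f : A ⇒ B} → f ∘ id ≈ f
    equiv     : ∀ {A B} → IsEquivalence (_≈_ {A} {B})
    ∘-resp-≈  : ∀ {A B C} {f f′ : B ⇒ C} {g g′ : A ⇒ B} → f ≈ f′ → g ≈ g′ → f ∘ g ≈ f′ ∘ g′

  module Equiv {A B : Obj} = IsEquivalence (equiv {A} {B})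

_ᵒᵖ : ∀ {o h e} → Category o h e → Category o h e
C ᵒᵖ = record
  { Obj       = Obj
  ; _⇒_       = λ A B → B ⇒ A
  ; _≈_       = _≈_
  ; id        = id
  ; _∘_       = λ f g → g ∘ f
  ; assoc     = Equiv.sym assoc
  ; identityˡ = identityʳ
  ; identityʳ = identityˡ
  ; equiv     = equiv
  ; ∘-resp-≈  = λ p q → ∘-resp-≈ q p
  }
  where open Category C

FullSubcategory : ∀ {o h e i} (C : Category o h e) {I : Set i} → (I → Category.Obj C) → Category i h e
FullSubcategory C {I} U = record
  { Obj       = I
  ; _⇒_       = λ A B → U A ⇒ U B
  ; _≈_       = _≈_
  ; id        = id
  ; _∘_       = _∘_
  ; assoc     = assoc
  ; identityˡ = identityˡ
  ; identityʳ = identityʳ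
  ; equiv     = equiv
  ; ∘-resp-≈  = ∘-resp-≈
  }
  where open Category C

record Functor {o h e o′ h′ e′} (C : Category o h e) (D : Category o′ h′ e′)
               : Set (o ⊔ h ⊔ e ⊔ o′ ⊔ h′ ⊔ e′) where
  private
    module C = Category C
    module D = Category D
  field
    F₀           : C.Obj → D.Obj
    F₁           : ∀ {A B} → A C.⇒ B → F₀ A D.⇒ F₀ B
    identity     : ∀ {A} → F₁ (C.id {A}) D.≈ D.id
    homomorphism : ∀ {A B E} {f : A C.⇒ B} {g : B C.⇒ E} → F₁ (g C.∘ f) D.≈ F₁ g D.∘ F₁ f
    F-resp-≈     : ∀ {A B} {f g : A C.⇒ B} → f C.≈ g → F₁ f D.≈ F₁ g

idF : ∀ {o h e} {C : Category o h e} → Functor C C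
idF {C = C} = record
  { F₀ = λ A → A ; F₁ = λ f → f ; identity = Equiv.refl ; homomorphism = Equiv.refl ; F-resp-≈ = λ p → p }
  where open Category C

infixr 9 _∘F_

_∘F_ : ∀ {o h e o′ h′ e′ o″ h″ e″} {C : Category o h e} {D : Category o′ h′ e′} {E : Category o″ h″ e″}
     → Functor D E → Functor C D → Functor C E
_∘F_ {E = E} G F = record
  { F₀           = λ A → G.F₀ (F.F₀ A)
  ; F₁           = λ f → G.F₁ (F.F₁ f)
  ; identity     = Equiv.trans (G.F-resp-≈ F.identity) G.identity
  ; homomorphism = Equiv.trans (G.F-resp-≈ F.homomorphism) G.homomorphism
  ; F-resp-≈     = λ p → G.F-resp-≈ (F.F-resp-≈ p)
  }
  where
    module F = Functor F
    module G = Functor G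
    open Category E

opF : ∀ {o h e o′ h′ e′} {C : Category o h e} {D : Category o′ h′ e′} → Functor C D → Functor (C ᵒᵖ) (D ᵒᵖ)
opF F = record
  { F₀ = F₀ ; F₁ = F₁ ; identity = identity ; homomorphism = homomorphism ; F-resp-≈ = F-resp-≈ }
  where open Functor F

record NaturalTransformation {o h e o′ h′ e′} {C : Category o h e} {D : Category o′ h′ e′}
                             (F G : Functor C D) : Set (o ⊔ h ⊔ e ⊔ o′ ⊔ h′ ⊔ e′) where
  private
    module C = Category C
    module F = Functor F
    module G = Functor G
  open Category D
  field
    η       : ∀ A → F.F₀ A ⇒ G.F₀ A
    commute : ∀ {A B} (f : A C.⇒ B) → η B ∘ F.F₁ f ≈ G.F₁ f ∘ η A

record NaturalIsomorphism {o h e o′ h′ e′} {C : Category o h e} {D : Category o′ h′ e′}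
                          (F G : Functor C D) : Set (o ⊔ h ⊔ e ⊔ o′ ⊔ h′ ⊔ e′) where
  open Category D
  field
    to   : NaturalTransformation F G
    from : NaturalTransformation G F
  module to   = NaturalTransformation to
  module from = NaturalTransformation from
  field
    isoˡ : ∀ A → from.η A ∘ to.η A ≈ id
    isoʳ : ∀ A → to.η A ∘ from.η A ≈ id

record CategoryEquivalence {o h e o′ h′ e′} (C : Category o h e) (D : Category o′ h′ e′)
                           : Set (o ⊔ h ⊔ e ⊔ o′ ⊔ h′ ⊔ e′) where
  field
    to     : Functor C D
    from   : Functor D C
    unit   : NaturalIsomorphism idF (from ∘F to)
    counit : NaturalIsomorphism (to ∘F from) idF

record FiniteProducts {o h e} (C : Category o h e) : Set (o ⊔ h ⊔ e) where
  open Category C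
  infixr 7 _⊗_
  field
    𝟙        : Obj
    !        : ∀ {A} → A ⇒ 𝟙
    !-unique : ∀ {A} (f : A ⇒ 𝟙) → f ≈ !
    _⊗_      : Obj → Obj → Obj
    π₁       : ∀ {A B} → A ⊗ B ⇒ A
    π₂       : ∀ {A B} → A ⊗ B ⇒ B
    ⟨_,_⟩    : ∀ {A B X} → X ⇒ A → X ⇒ B → X ⇒ A ⊗ B
    project₁ : ∀ {A B X} {f : X ⇒ A} {g : X ⇒ B} → π₁ ∘ ⟨ f , g ⟩ ≈ f
    project₂ : ∀ {A B X} {f : X ⇒ A} {g : X ⇒ B} → π₂ ∘ ⟨ f , g ⟩ ≈ g
    unique   : ∀ {A B X} {f : X ⇒ A} {g : X ⇒ B} {k : X ⇒ A ⊗ B} → π₁ ∘ k ≈ f → π₂ ∘ k ≈ g → ⟨ f , g ⟩ ≈ k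

record Pullback {o h e} (C : Category o h e) {X Y Z : Category.Obj C}
                (f : Category._⇒_ C X Z) (g : Category._⇒_ C Y Z) : Set (o ⊔ h ⊔ e) where
  open Category C
  field
    P         : Obj
    p₁        : P ⇒ X
    p₂        : P ⇒ Y
    commute   : f ∘ p₁ ≈ g ∘ p₂
    universal : ∀ {W} (u : W ⇒ X) (v : W ⇒ Y) → f ∘ u ≈ g ∘ v → W ⇒ P
    p₁∘universal : ∀ {W} {u : W ⇒ X} {v : W ⇒ Y} {eq : f ∘ u ≈ g ∘ v} → p₁ ∘ universal u v eq ≈ u
    p₂∘universal : ∀ {W} {u : W ⇒ X} {v : W ⇒ Y} {eq : f ∘ u ≈ g ∘ v} → p₂ ∘ universal u v eq ≈ v
    unique    : ∀ {W} {k k′ : W ⇒ P} → p₁ ∘ k ≈ p₁ ∘ k′ → p₂ ∘ k ≈ p₂ ∘ k′ → k ≈ k′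

record MeetHom {c ℓ₁ ℓ₂} (L M : BoundedMeetSemilattice c ℓ₁ ℓ₂) : Set (c ⊔ ℓ₁ ⊔ ℓ₂) where
  private
    module L = BoundedMeetSemilattice L
    module M = BoundedMeetSemilattice M
  field
    ⟦_⟧    : L.Carrier → M.Carrier
    mono   : ∀ {x y} → x L.≤ y → ⟦ x ⟧ M.≤ ⟦ y ⟧
    ∧-homo : ∀ x y → ⟦ x L.∧ y ⟧ M.≈ ⟦ x ⟧ M.∧ ⟦ y ⟧
    ⊤-homo : ⟦ L.⊤ ⟧ M.≈ M.⊤

  cong-≈ : ∀ {x y} → x L.≈ y → ⟦ x ⟧ M.≈ ⟦ y ⟧
  cong-≈ p = M.antisym (mono (L.reflexive p)) (mono (L.reflexive (L.Eq.sym p)))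

InfSL : ∀ c ℓ₁ ℓ₂ → Category (lsuc (c ⊔ ℓ₁ ⊔ ℓ₂)) (c ⊔ ℓ₁ ⊔ ℓ₂) (c ⊔ ℓ₁)
InfSL c ℓ₁ ℓ₂ = record
  { Obj       = BoundedMeetSemilattice c ℓ₁ ℓ₂
  ; _⇒_       = MeetHom
  ; _≈_       = λ {L} {M} f g → ∀ x → BoundedMeetSemilattice._≈_ M (⟦ f ⟧ x) (⟦ g ⟧ x)
  ; id        = λ {L} → record
      { ⟦_⟧ = λ x → x ; mono = λ p → p
      ; ∧-homo = λ _ _ → Eq.refl L ; ⊤-homo = Eq.refl L }
  ; _∘_       = λ {_} {_} {N} g f → record
      { ⟦_⟧    = λ x → ⟦ g ⟧ (⟦ f ⟧ x)
      ; mono   = λ p → mono g (mono f p)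
      ; ∧-homo = λ x y → Eq.trans N (cong-≈ g (∧-homo f x y)) (∧-homo g _ _)
      ; ⊤-homo = Eq.trans N (cong-≈ g (⊤-homo f)) (⊤-homo g) }
  ; assoc     = λ {_} {_} {_} {N} _ → Eq.refl N
  ; identityˡ = λ {_} {M} _ → Eq.refl M
  ; identityʳ = λ {_} {M} _ → Eq.refl M
  ; equiv     = λ {_} {M} → record
      { refl = λ _ → Eq.refl M ; sym = λ p x → Eq.sym M (p x) ; trans = λ p q x → Eq.trans M (p x) (q x) }
  ; ∘-resp-≈  = λ {_} {_} {N} {f} {f′} {g} {g′} p q x → Eq.trans N (cong-≈ f (q x)) (p (⟦ g′ ⟧ x))
  }
  where
    open MeetHom
    module Eq (L : BoundedMeetSemilattice c ℓ₁ ℓ₂) = IsEquivalence (BoundedMeetSemilattice.isEquivalence L)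

record Doctrine {o h e} (C : Category o h e) (c ℓ₁ ℓ₂ : Level) : Set (o ⊔ h ⊔ e ⊔ lsuc (c ⊔ ℓ₁ ⊔ ℓ₂)) where
  field
    functor : Functor (C ᵒᵖ) (InfSL c ℓ₁ ℓ₂)
  open Functor functor public

module DoctrineNotation {o h e c ℓ₁ ℓ₂} {C : Category o h e} (P : Doctrine C c ℓ₁ ℓ₂) where
  open Category C using (Obj; _⇒_)
  private
    module P = Doctrine P
    module Fib (A : Obj) = BoundedMeetSemilattice (P.F₀ A)

  Pred : Obj → Set c
  Pred A = Fib.Carrier A

  infix  4 _⊢_ _≃_
  infixr 7 _⋀_
  infixr 8 _⋆_

  _⊢_ : ∀ {A} → Rel (Pred A) ℓ₂
  _⊢_ {A} = Fib._≤_ A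

  _≃_ : ∀ {A} → Rel (Pred A) ℓ₁
  _≃_ {A} = Fib._≈_ A

  _⋀_ : ∀ {A} → Pred A → Pred A → Pred A
  _⋀_ {A} = Fib._∧_ A

  -- f ⋆ α is the reindexing P_f(α).
  _⋆_ : ∀ {A B} → A ⇒ B → Pred B → Pred A
  f ⋆ α = MeetHom.⟦_⟧ (P.F₁ f) α

-- The 2-category of doctrines: 1-arrows are pairs (F , b) with F a functor between the
-- bases and b : P → R ∘ Fᵒᵖ natural; a 2-arrow θ : (F , b) → (G , c) is a natural
-- transformation θ : F → G with b_A(α) ≤ R_{θ_A}(c_A(α)).

record DoctrineMorphism {o h e o′ h′ e′ c ℓ₁ ℓ₂} {C : Category o h e} {D : Category o′ h′ e′}
                        (P : Doctrine C c ℓ₁ ℓ₂) (R : Doctrine D c ℓ₁ ℓ₂)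
                        : Set (o ⊔ h ⊔ e ⊔ o′ ⊔ h′ ⊔ e′ ⊔ lsuc (c ⊔ ℓ₁ ⊔ ℓ₂)) where
  field
    base  : Functor C D
    fibre : NaturalTransformation (Doctrine.functor P) (Doctrine.functor R ∘F opF base)

  private
    module P = DoctrineNotation P
    module R = DoctrineNotation R

  fibre₀ : ∀ A → P.Pred A → R.Pred (Functor.F₀ base A)
  fibre₀ A = MeetHom.⟦_⟧ (NaturalTransformation.η fibre A)

idD : ∀ {o h e c ℓ₁ ℓ₂} {C : Category o h e} {P : Doctrine C c ℓ₁ ℓ₂} → DoctrineMorphism P P
idD {c = c} {ℓ₁} {ℓ₂} {P = P} = record
  { base  = idF
  ; fibre = record
      { η       = λ A → id
      ; commute = λ f → Equiv.refl {x = Doctrine.F₁ P f} }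
  }
  where open Category (InfSL c ℓ₁ ℓ₂)

infixr 9 _∘D_

_∘D_ : ∀ {o h e o′ h′ e′ o″ h″ e″ c ℓ₁ ℓ₂}
         {C : Category o h e} {D : Category o′ h′ e′} {E : Category o″ h″ e″}
         {P : Doctrine C c ℓ₁ ℓ₂} {R : Doctrine D c ℓ₁ ℓ₂} {S : Doctrine E c ℓ₁ ℓ₂}
     → DoctrineMorphism R S → DoctrineMorphism P R → DoctrineMorphism P S
_∘D_ {S = S} N M = record
  { base  = N.base ∘F M.base
  ; fibre = record
      { η       = λ A → record
          { ⟦_⟧    = λ α → ⟦ n.η _ ⟧ (⟦ m.η A ⟧ α)
          ; mono   = λ p → mono (n.η _) (mono (m.η A) p)
          ; ∧-homo = λ α β → Eq.trans (cong-≈ (n.η _) (∧-homo (m.η A) α β)) (∧-homo (n.η _) _ _)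
          ; ⊤-homo = Eq.trans (cong-≈ (n.η _) (⊤-homo (m.η A))) (⊤-homo (n.η _)) }
      ; commute = λ f α → Eq.trans (cong-≈ (n.η _) (m.commute f α)) (n.commute (Functor.F₁ M.base f) _) }
  }
  where
    module N = DoctrineMorphism N
    module M = DoctrineMorphism M
    module n = NaturalTransformation N.fibre
    module m = NaturalTransformation M.fibre
    open MeetHom
    module Eq {X} = IsEquivalence (BoundedMeetSemilattice.isEquivalence (Doctrine.F₀ S X))

module _ {o h e o′ h′ e′ c ℓ₁ ℓ₂} {C : Category o h e} {D : Category o′ h′ e′}
         {P : Doctrine C c ℓ₁ ℓ₂} {R : Doctrine D c ℓ₁ ℓ₂} where

  private
    module P = DoctrineNotation P
    module R = DoctrineNotation R

  record DoctrineTransformation (M N : DoctrineMorphism P R)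
                                : Set (o ⊔ h ⊔ e ⊔ o′ ⊔ h′ ⊔ e′ ⊔ c ⊔ ℓ₂) where
    private
      module M = DoctrineMorphism M
      module N = DoctrineMorphism N
    field
      θ   : NaturalTransformation M.base N.base
    open NaturalTransformation θ public
    field
      lax : ∀ A (α : P.Pred A) → M.fibre₀ A α R.⊢ η A R.⋆ N.fibre₀ A α

  record DoctrineIsomorphism (M N : DoctrineMorphism P R)
                             : Set (o ⊔ h ⊔ e ⊔ o′ ⊔ h′ ⊔ e′ ⊔ c ⊔ ℓ₂) where
    open Category D
    field
      to   : DoctrineTransformation M N
      from : DoctrineTransformation N M
    module to   = DoctrineTransformation to
    module from = DoctrineTransformation from
    field
      isoˡ : ∀ A → from.η A ∘ to.η A ≈ id
      isoʳ : ∀ A → to.η A ∘ from.η A ≈ id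

record DoctrineEquivalence {o h e o′ h′ e′ c ℓ₁ ℓ₂} {C : Category o h e} {D : Category o′ h′ e′}
                           (P : Doctrine C c ℓ₁ ℓ₂) (R : Doctrine D c ℓ₁ ℓ₂)
                           : Set (o ⊔ h ⊔ e ⊔ o′ ⊔ h′ ⊔ e′ ⊔ lsuc (c ⊔ ℓ₁ ⊔ ℓ₂)) where
  field
    to     : DoctrineMorphism P R
    from   : DoctrineMorphism R P
    unit   : DoctrineIsomorphism idD (from ∘D to)
    counit : DoctrineIsomorphism (to ∘D from) idD

record ElementaryDoctrine {o h e} (C : Category o h e) (c ℓ₁ ℓ₂ : Level)
                          : Set (o ⊔ h ⊔ e ⊔ lsuc (c ⊔ ℓ₁ ⊔ ℓ₂)) where
  field
    products : FiniteProducts C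
    doctrine : Doctrine C c ℓ₁ ℓ₂
  open Category C
  open FiniteProducts products public
  open DoctrineNotation doctrine public

  -- A ternary product X × A × B is (X ⊗ A) ⊗ B.
  pr₁ : ∀ {X A B} → (X ⊗ A) ⊗ B ⇒ X
  pr₁ = π₁ ∘ π₁

  pr₂ : ∀ {X A B} → (X ⊗ A) ⊗ B ⇒ A
  pr₂ = π₂ ∘ π₁

  pr₃ : ∀ {X A B} → (X ⊗ A) ⊗ B ⇒ B
  pr₃ = π₂

  field
    δ         : ∀ A → Pred (A ⊗ A)
    δ-adjoint : ∀ {X A} (α : Pred (X ⊗ A)) (β : Pred ((X ⊗ A) ⊗ A))
              → ⟨ pr₁ , pr₂ ⟩ ⋆ α ⋀ ⟨ pr₂ , pr₃ ⟩ ⋆ δ A ⊢ β ⇔ α ⊢ ⟨ ⟨ π₁ , π₂ ⟩ , π₂ ⟩ ⋆ β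

module QuotientCompletion {o h e c ℓ₁ ℓ₂} {C : Category o h e} (E : ElementaryDoctrine C c ℓ₁ ℓ₂) where
  open Category C
  open ElementaryDoctrine E

  record IsEquivalenceRelation {A : Obj} (ρ : Pred (A ⊗ A)) : Set ℓ₂ where
    field
      reflexive  : δ A ⊢ ρ
      symmetric  : ρ ⊢ ⟨ π₂ , π₁ ⟩ ⋆ ρ
      transitive : ⟨ pr₁ , pr₂ ⟩ ⋆ ρ ⋀ ⟨ pr₂ , pr₃ ⟩ ⋆ ρ ⊢ ⟨ pr₁ , pr₃ ⟩ ⋆ ρ

  record QObj : Set (o ⊔ c ⊔ ℓ₂) where
    field
      obj   : Obj
      rel   : Pred (obj ⊗ obj)
      isEqv : IsEquivalenceRelation rel
    open IsEquivalenceRelation isEqv public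

  open QObj using (obj; rel)

  record QHom (A B : QObj) : Set (h ⊔ ℓ₂) where
    field
      arr : obj A ⇒ obj B
      ext : rel A ⊢ ⟨ arr ∘ π₁ , arr ∘ π₂ ⟩ ⋆ rel B

  open QHom using (arr)

  _∼_ : ∀ {A B} → Rel (QHom A B) ℓ₂
  _∼_ {A} {B} f g = rel A ⊢ ⟨ arr f ∘ π₁ , arr g ∘ π₂ ⟩ ⋆ rel B

  record Descent (A : QObj) : Set (c ⊔ ℓ₂) where
    field
      pred    : Pred (obj A)
      descent : π₁ ⋆ pred ⋀ rel A ⊢ π₂ ⋆ pred

  open Descent using (pred; descent)

  private
    module P = Doctrine doctrine
    module F (A : Obj) = BoundedMeetSemilattice (P.F₀ A)

    ⊢-refl : ∀ {A} {α : Pred A} → α ⊢ α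
    ⊢-refl {A} = F.refl A

    infixr 5 _⨾_
    _⨾_ : ∀ {A} {α β γ : Pred A} → α ⊢ β → β ⊢ γ → α ⊢ γ
    _⨾_ {A} = F.trans A

    ≃⇒⊢ : ∀ {A} {α β : Pred A} → α ≃ β → α ⊢ β
    ≃⇒⊢ {A} = F.reflexive A

    ≃⇒⊣ : ∀ {A} {α β : Pred A} → α ≃ β → β ⊢ α
    ≃⇒⊣ {A} p = F.reflexive A (F.Eq.sym A p)

    ⋀-intro : ∀ {A} {α β γ : Pred A} → α ⊢ β → α ⊢ γ → α ⊢ β ⋀ γ
    ⋀-intro {A} = F.∧-greatest A

    ⋀₁ : ∀ {A} {α β : Pred A} → α ⋀ β ⊢ α
    ⋀₁ {A} = F.x∧y≤x A _ _

    ⋀₂ : ∀ {A} {α β : Pred A} → α ⋀ β ⊢ β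
    ⋀₂ {A} = F.x∧y≤y A _ _

    ⋆-mono : ∀ {A B} (f : A ⇒ B) {α β} → α ⊢ β → f ⋆ α ⊢ f ⋆ β
    ⋆-mono f = MeetHom.mono (P.F₁ f)

    fuse : ∀ {A B X} {f : B ⇒ X} {g : A ⇒ B} {k : A ⇒ X} {α} → f ∘ g ≈ k → g ⋆ (f ⋆ α) ⊢ k ⋆ α
    fuse p = ≃⇒⊣ (P.homomorphism _) ⨾ ≃⇒⊢ (P.F-resp-≈ p _)

    split : ∀ {A B X} {f : B ⇒ X} {g : A ⇒ B} {k : A ⇒ X} {α} → f ∘ g ≈ k → k ⋆ α ⊢ g ⋆ (f ⋆ α)
    split p = ≃⇒⊣ (P.F-resp-≈ p _) ⨾ ≃⇒⊢ (P.homomorphism _)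

    ⋆-id : ∀ {A} {f : A ⇒ A} {α} → f ≈ id → α ⊢ f ⋆ α
    ⋆-id p = ≃⇒⊣ (P.identity _) ⨾ ≃⇒⊣ (P.F-resp-≈ p _)

    pair-∘ : ∀ {A B X Y} {f : X ⇒ A} {g : X ⇒ B} {k : Y ⇒ X} → ⟨ f , g ⟩ ∘ k ≈ ⟨ f ∘ k , g ∘ k ⟩
    pair-∘ = Equiv.sym (unique (Equiv.trans (Equiv.sym assoc) (∘-resp-≈ project₁ Equiv.refl))
                               (Equiv.trans (Equiv.sym assoc) (∘-resp-≈ project₂ Equiv.refl)))

    pair-≈ : ∀ {A B X} {f f′ : X ⇒ A} {g g′ : X ⇒ B} → f ≈ f′ → g ≈ g′ → ⟨ f , g ⟩ ≈ ⟨ f′ , g′ ⟩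
    pair-≈ p q = unique (Equiv.trans project₁ (Equiv.sym p)) (Equiv.trans project₂ (Equiv.sym q))

    at : ∀ {A B X Y} {f : X ⇒ A} {g : X ⇒ B} {k : Y ⇒ X} {u v} → f ∘ k ≈ u → g ∘ k ≈ v → ⟨ f , g ⟩ ∘ k ≈ ⟨ u , v ⟩
    at p q = Equiv.trans pair-∘ (pair-≈ p q)

    under₁ : ∀ {A B X Y} {f : A ⇒ Y} {u : X ⇒ A} {v : X ⇒ B} → (f ∘ π₁) ∘ ⟨ u , v ⟩ ≈ f ∘ u
    under₁ = Equiv.trans assoc (∘-resp-≈ Equiv.refl project₁)

    under₂ : ∀ {A B X Y} {f : B ⇒ Y} {u : X ⇒ A} {v : X ⇒ B} → (f ∘ π₂) ∘ ⟨ u , v ⟩ ≈ f ∘ v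
    under₂ = Equiv.trans assoc (∘-resp-≈ Equiv.refl project₂)

    pr₁-at : ∀ {A B D X} {u : X ⇒ A} {v : X ⇒ B} {w : X ⇒ D} → pr₁ ∘ ⟨ ⟨ u , v ⟩ , w ⟩ ≈ u
    pr₁-at = Equiv.trans under₁ project₁

    pr₂-at : ∀ {A B D X} {u : X ⇒ A} {v : X ⇒ B} {w : X ⇒ D} → pr₂ ∘ ⟨ ⟨ u , v ⟩ , w ⟩ ≈ v
    pr₂-at = Equiv.trans under₁ project₂

    module _ (A : QObj) where
      private ρ = rel A

      rel-sym : ∀ {X} {u v : X ⇒ obj A} → ⟨ u , v ⟩ ⋆ ρ ⊢ ⟨ v , u ⟩ ⋆ ρ
      rel-sym = ⋆-mono _ (QObj.symmetric A) ⨾ fuse (at project₂ project₁)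

      rel-trans : ∀ {X} {u v w : X ⇒ obj A} {γ} → γ ⊢ ⟨ u , v ⟩ ⋆ ρ → γ ⊢ ⟨ v , w ⟩ ⋆ ρ → γ ⊢ ⟨ u , w ⟩ ⋆ ρ
      rel-trans {u = u} {v} {w} p q =
          ⋀-intro (p ⨾ split (at pr₁-at pr₂-at)) (q ⨾ split (at pr₂-at project₂))
        ⨾ ≃⇒⊣ (MeetHom.∧-homo (P.F₁ ⟨ ⟨ u , v ⟩ , w ⟩) _ _)
        ⨾ ⋆-mono ⟨ ⟨ u , v ⟩ , w ⟩ (QObj.transitive A)
        ⨾ fuse (at pr₁-at project₂)

      rel-gen : ρ ⊢ ⟨ π₁ , π₂ ⟩ ⋆ ρ
      rel-gen = ⋆-id (unique identityʳ identityʳ)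

      rel-refl₂ : ρ ⊢ ⟨ π₂ , π₂ ⟩ ⋆ ρ
      rel-refl₂ = rel-trans (rel-gen ⨾ rel-sym) rel-gen

      rel-refl : ∀ {γ : Pred (obj A)} → γ ⊢ ⟨ id , id ⟩ ⋆ ρ
      rel-refl = F.maximum _ _
               ⨾ ≃⇒⊣ (MeetHom.⊤-homo (P.F₁ ⟨ id , id ⟩))
               ⨾ ⋆-mono ⟨ id , id ⟩ ⊤⊢
               ⨾ fuse (at project₂ project₂)
        where
          ⊤⊢ : F.⊤ (obj A ⊗ obj A) ⊢ ⟨ π₂ , π₂ ⟩ ⋆ ρ
          ⊤⊢ = Function.Equivalence.to (δ-adjoint _ _) (⋀₂ ⨾ ⋆-mono _ (QObj.reflexive A))
             ⨾ fuse (at pr₂-at project₂)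

      rel-at : ∀ {B X} {f g : QHom B A} {u v : X ⇒ obj B} → f ∼ g
             → ⟨ u , v ⟩ ⋆ rel B ⊢ ⟨ arr f ∘ u , arr g ∘ v ⟩ ⋆ ρ
      rel-at p = ⋆-mono _ p ⨾ fuse (at under₁ under₂)

    ∼-refl : ∀ {A B} {f : QHom A B} → f ∼ f
    ∼-refl {f = f} = QHom.ext f

    ∼-sym : ∀ {A B} {f g : QHom A B} → f ∼ g → g ∼ f
    ∼-sym {A} {B} {f} {g} p = rel-gen A ⨾ rel-sym A ⨾ rel-at B {f = f} {g} p ⨾ rel-sym B

    ∼-trans : ∀ {A B} {f g k : QHom A B} → f ∼ g → g ∼ k → f ∼ k
    ∼-trans {A} {B} {f} {g} {k} p q = rel-trans B p (rel-refl₂ A ⨾ rel-at B {f = g} {k} q)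

    ≈⇒∼ : ∀ {A B} {f g : QHom A B} → arr f ≈ arr g → f ∼ g
    ≈⇒∼ {f = f} p = QHom.ext f ⨾ ≃⇒⊢ (P.F-resp-≈ (pair-≈ Equiv.refl (∘-resp-≈ p Equiv.refl)) _)

    idQ : ∀ {A} → QHom A A
    idQ {A} = record
      { arr = id
      ; ext = ⋆-id (unique (Equiv.trans identityʳ (Equiv.sym identityˡ)) (Equiv.trans identityʳ (Equiv.sym identityˡ))) }

    ∘-ext : ∀ {A B D} {f f′ : QHom B D} {g g′ : QHom A B} → f ∼ f′ → g ∼ g′
          → rel A ⊢ ⟨ (arr f ∘ arr g) ∘ π₁ , (arr f′ ∘ arr g′) ∘ π₂ ⟩ ⋆ rel D
    ∘-ext {D = D} {f} {f′} p q = q ⨾ rel-at D {f = f} {f′} p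
                     ⨾ ≃⇒⊣ (P.F-resp-≈ (pair-≈ assoc assoc) _)

    compQ : ∀ {A B D} → QHom B D → QHom A B → QHom A D
    compQ f g = record { arr = arr f ∘ arr g ; ext = ∘-ext {f = f} {f} {g} {g} (QHom.ext f) (QHom.ext g) }

  Q : Category (o ⊔ c ⊔ ℓ₂) (h ⊔ ℓ₂) ℓ₂
  Q = record
    { Obj       = QObj
    ; _⇒_       = QHom
    ; _≈_       = _∼_
    ; id        = idQ
    ; _∘_       = compQ
    ; assoc     = λ {_} {_} {_} {_} {f} {g} {k} → ≈⇒∼ {f = compQ (compQ k g) f} {compQ k (compQ g f)} assoc
    ; identityˡ = λ {_} {_} {f} → ≈⇒∼ {f = compQ idQ f} {f} identityˡ
    ; identityʳ = λ {_} {_} {f} → ≈⇒∼ {f = compQ f idQ} {f} identityʳ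
    ; equiv     = record
        { refl  = λ {f} → ∼-refl {f = f}
        ; sym   = λ {f} {g} → ∼-sym {f = f} {g}
        ; trans = λ {f} {g} {k} → ∼-trans {f = f} {g} {k} }
    ; ∘-resp-≈  = λ {_} {_} {_} {f} {f′} {g} {g′} → ∘-ext {f = f} {f′} {g} {g′}
    }

  private
    DescentSL : QObj → BoundedMeetSemilattice (c ⊔ ℓ₂) ℓ₁ ℓ₂
    DescentSL A = record
      { Carrier = Descent A
      ; _≈_     = λ α β → pred α ≃ pred β
      ; _≤_     = λ α β → pred α ⊢ pred β
      ; _∧_     = λ α β → record
          { pred    = pred α ⋀ pred β
          ; descent = ⋀-intro
                (⋀-intro (⋀₁ ⨾ ⋆-mono π₁ ⋀₁) ⋀₂ ⨾ descent α)
                (⋀-intro (⋀₁ ⨾ ⋆-mono π₁ ⋀₂) ⋀₂ ⨾ descent β)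
              ⨾ ≃⇒⊣ (MeetHom.∧-homo (P.F₁ π₂) _ _) }
      ; ⊤       = record
          { pred    = F.⊤ (obj A)
          ; descent = F.maximum _ _ ⨾ ≃⇒⊣ (MeetHom.⊤-homo (P.F₁ π₂)) }
      ; isBoundedMeetSemilattice = record
          { isMeetSemilattice = record
              { isPartialOrder = record
                  { isPreorder = record
                      { isEquivalence = record { refl = F.Eq.refl _ ; sym = F.Eq.sym _ ; trans = F.Eq.trans _ }
                      ; reflexive     = F.reflexive _
                      ; trans         = F.trans _ }
                  ; antisym = F.antisym _ }
              ; infimum = λ α β → ⋀₁ , ⋀₂ , λ γ → ⋀-intro }
          ; maximum = λ α → F.maximum _ _ }
      }

    reindexQ : ∀ {A B} → QHom A B → MeetHom (DescentSL B) (DescentSL A)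
    reindexQ f = record
      { ⟦_⟧    = λ α → record
          { pred    = arr f ⋆ pred α
          ; descent = ⋀-intro (⋀₁ ⨾ fuse Equiv.refl ⨾ split project₁) (⋀₂ ⨾ QHom.ext f)
                    ⨾ ≃⇒⊣ (MeetHom.∧-homo (P.F₁ ⟨ arr f ∘ π₁ , arr f ∘ π₂ ⟩) _ _)
                    ⨾ ⋆-mono _ (descent α)
                    ⨾ fuse project₂ ⨾ split Equiv.refl }
      ; mono   = ⋆-mono (arr f)
      ; ∧-homo = λ α β → MeetHom.∧-homo (P.F₁ (arr f)) _ _
      ; ⊤-homo = MeetHom.⊤-homo (P.F₁ (arr f))
      }

    reindexQ-≤ : ∀ {A B} (f g : QHom A B) → f ∼ g → (α : Descent B) → arr f ⋆ pred α ⊢ arr g ⋆ pred α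
    reindexQ-≤ {A} {B} f g p α =
        ⋀-intro (split project₁) (rel-refl A ⨾ rel-at B {f = f} {g} p
                                  ⨾ ≃⇒⊢ (P.F-resp-≈ (pair-≈ identityʳ identityʳ) _))
      ⨾ ≃⇒⊣ (MeetHom.∧-homo (P.F₁ ⟨ arr f , arr g ⟩) _ _)
      ⨾ ⋆-mono _ (descent α)
      ⨾ fuse project₂

  P̄ : Doctrine Q (c ⊔ ℓ₂) ℓ₁ ℓ₂
  P̄ = record { functor = record
    { F₀           = DescentSL
    ; F₁           = reindexQ
    ; identity     = λ α → P.identity _
    ; homomorphism = λ α → P.homomorphism _
    ; F-resp-≈     = λ {_} {_} {f} {g} p α →
        F.antisym _ (reindexQ-≤ f g p α) (reindexQ-≤ g f (∼-sym {f = f} {g} p) α)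
    } }

data PR : ℕ → Set where
  zeroᶠ : ∀ {n} → PR n
  succᶠ : PR 1
  proj  : ∀ {n} → Fin n → PR n
  comp  : ∀ {n m} → PR m → Vec (PR n) m → PR n
  prec  : ∀ {n} → PR n → PR (2 + n) → PR (1 + n)
  min   : ∀ {n} → PR (1 + n) → PR n

infix 4 _·_⇓_ _·_⇓*_

-- c · xs ⇓ y : the partial function described by c is defined at xs, with value y.
data _·_⇓_ : ∀ {n} → PR n → Vec ℕ n → ℕ → Set
data _·_⇓*_ : ∀ {n m} → Vec (PR n) m → Vec ℕ n → Vec ℕ m → Set

data _·_⇓_ where
  ⇓zero  : ∀ {n} {xs : Vec ℕ n} → zeroᶠ · xs ⇓ 0
  ⇓succ  : ∀ {x} → succᶠ · x ∷ [] ⇓ suc x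
  ⇓proj  : ∀ {n} {xs : Vec ℕ n} (i : Fin n) → proj i · xs ⇓ lookup xs i
  ⇓comp  : ∀ {n m} {f : PR m} {gs : Vec (PR n) m} {xs ys z}
         → gs · xs ⇓* ys → f · ys ⇓ z → comp f gs · xs ⇓ z
  ⇓prec₀ : ∀ {n} {g : PR n} {h xs y} → g · xs ⇓ y → prec g h · 0 ∷ xs ⇓ y
  ⇓precₛ : ∀ {n} {g : PR n} {h k xs y z}
         → prec g h · k ∷ xs ⇓ y → h · k ∷ y ∷ xs ⇓ z → prec g h · suc k ∷ xs ⇓ z
  ⇓min   : ∀ {n} {f : PR (1 + n)} {xs y}
         → f · y ∷ xs ⇓ 0 → (∀ i → i < y → ∃ λ z → f · i ∷ xs ⇓ suc z) → min f · xs ⇓ y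

data _·_⇓*_ where
  []  : ∀ {n} {xs : Vec ℕ n} → [] · xs ⇓* []
  _∷_ : ∀ {n m} {g : PR n} {gs : Vec (PR n) m} {xs y ys}
      → g · xs ⇓ y → gs · xs ⇓* ys → g ∷ gs · xs ⇓* y ∷ ys

⇓-functional  : ∀ {n} {c : PR n} {xs y z} → c · xs ⇓ y → c · xs ⇓ z → y ≡ z
⇓*-functional : ∀ {n m} {cs : Vec (PR n) m} {xs ys zs} → cs · xs ⇓* ys → cs · xs ⇓* zs → ys ≡ zs

⇓-functional ⇓zero ⇓zero = refl
⇓-functional ⇓succ ⇓succ = refl
⇓-functional (⇓proj i) (⇓proj .i) = refl
⇓-functional (⇓comp ps p) (⇓comp qs q) with refl ← ⇓*-functional ps qs = ⇓-functional p q
⇓-functional (⇓prec₀ p) (⇓prec₀ q) = ⇓-functional p q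
⇓-functional (⇓precₛ p p′) (⇓precₛ q q′) with refl ← ⇓-functional p q = ⇓-functional p′ q′
⇓-functional (⇓min {y = y} p p<) (⇓min {y = z} q q<) with <-cmp y z
... | tri≈ _ y≡z _ = y≡z
... | tri< y<z _ _ = contradiction (⇓-functional p (proj₂ (q< y y<z))) λ ()
... | tri> _ _ z<y = contradiction (⇓-functional (proj₂ (p< z z<y)) q) λ ()

⇓*-functional [] [] = refl
⇓*-functional (p ∷ ps) (q ∷ qs) = cong₂ _∷_ (⇓-functional p q) (⇓*-functional ps qs)

-- An injective pairing function, opaque to keep terms small.
opaque
  pair : ℕ → ℕ → ℕ
  pair m n = (m + n) * (m + n) + m

root : ℕ → ℕ
root zero = 0
root (suc k) with suc (root k) * suc (root k) ≤? suc k
... | yes _ = suc (root k)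
... | no  _ = root k

opaque
  fst : ℕ → ℕ
  fst k = k ∸ root k * root k

  snd : ℕ → ℕ
  snd k = root k ∸ fst k

private
  root-lower : ∀ k → root k * root k ≤ k
  root-lower zero = z≤n
  root-lower (suc k) with suc (root k) * suc (root k) ≤? suc k
  ... | yes p = p
  ... | no  _ = m≤n⇒m≤1+n (root-lower k)

  root-upper : ∀ k → k < suc (root k) * suc (root k)
  root-upper zero = s≤s z≤n
  root-upper (suc k) with suc (root k) * suc (root k) ≤? suc k
  ... | yes _ = ≤-<-trans (root-upper k) (*-mono-< {suc (root k)} ≤-refl ≤-refl)
  ... | no ¬p = ≰⇒> ¬p

  square-≤ : ∀ {r s k} → r * r ≤ k → k < suc s * suc s → r ≤ s
  square-≤ {r} {s} lo hi with r ≤? s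
  ... | yes p = p
  ... | no ¬p = contradiction (<-≤-trans hi (≤-trans (*-mono-≤ (≰⇒> ¬p) (≰⇒> ¬p)) lo)) (<-irrefl refl)

  opaque
    unfolding pair

    pair-upper : ∀ m n → pair m n < suc (m + n) * suc (m + n)
    pair-upper m n = ≤-<-trans (≤-reflexive (+-comm ((m + n) * (m + n)) m))
      (+-mono-<-≤ {m} (s≤s (m≤m+n m n)) (*-monoʳ-≤ (m + n) (n≤1+n (m + n))))

    pair-lower : ∀ m n → (m + n) * (m + n) ≤ pair m n
    pair-lower m n = m≤m+n ((m + n) * (m + n)) m

  root-pair : ∀ m n → root (pair m n) ≡ m + n
  root-pair m n = ≤-antisym
    (square-≤ {root (pair m n)} {m + n} (root-lower (pair m n)) (pair-upper m n))
    (square-≤ {m + n} {root (pair m n)} (pair-lower m n) (root-upper (pair m n)))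

opaque
  unfolding pair fst

  fst-pair : ∀ m n → fst (pair m n) ≡ m
  fst-pair m n = trans (cong (λ r → (m + n) * (m + n) + m ∸ r * r) (root-pair m n)) (m+n∸m≡n ((m + n) * (m + n)) m)

  snd-pair : ∀ m n → snd (pair m n) ≡ n
  snd-pair m n = trans (cong₂ _∸_ (root-pair m n) (fst-pair m n)) (m+n∸m≡n m n)

pair-injective : ∀ {m n m′ n′} → pair m n ≡ pair m′ n′ → m ≡ m′ × n ≡ n′
pair-injective {m} {n} {m′} {n′} p =
    trans (sym (fst-pair m n)) (trans (cong fst p) (fst-pair m′ n′))
  , trans (sym (snd-pair m n)) (trans (cong snd p) (snd-pair m′ n′))

-- decode k n e is the n-ary description coded by e, where k bounds the nesting depth;
-- the head constructor is fst e and its arguments are in snd e. Numbers that code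
-- nothing describe a constant zero function.
decode  : ℕ → (n : ℕ) → ℕ → PR n
decodes : ℕ → (n m : ℕ) → ℕ → Vec (PR n) m
build   : ℕ → (tag n body : ℕ) → PR n

decode zero    n e = zeroᶠ
decode (suc k) n e = build k (fst e) n (snd e)

decodes k n zero    e = []
decodes k n (suc m) e = decode k n (fst e) ∷ decodes k n m (snd e)

build k 1 1       b = succᶠ
build k 2 n       b with b <? n
... | yes b<n = proj (fromℕ< b<n)
... | no  _   = zeroᶠ
build k 3 n       b = comp (decode k (fst b) (fst (snd b))) (decodes k n (fst b) (snd (snd b)))
build k 4 (suc n) b = prec (decode k n (fst b)) (decode k (2 + n) (snd b))
build k 5 n       b = min (decode k (suc n) b)
build k _ n       b = zeroᶠ

-- The depth bound e suffices for every description coded by e (see encode-decode).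
program : ℕ → PR 1
program e = decode e 1 e

-- The graph of the e-th partial recursive function: φ e n m means φ_e(n) is defined and equals m.
φ : ℕ → ℕ → ℕ → Set
φ e n m = program e · n ∷ [] ⇓ m

φ-functional : ∀ {e n m m′} → φ e n m → φ e n m′ → m ≡ m′
φ-functional = ⇓-functional

encode  : ∀ {n} → PR n → ℕ
encodes : ∀ {n m} → Vec (PR n) m → ℕ

encode zeroᶠ = pair 0 0
encode succᶠ = pair 1 0
encode (proj i) = pair 2 (toℕ i)
encode (comp {m = m} f gs) = pair 3 (pair m (pair (encode f) (encodes gs)))
encode (prec g h) = pair 4 (pair (encode g) (encode h))
encode (min f) = pair 5 (encode f)

encodes [] = 0
encodes (c ∷ cs) = pair (encode c) (encodes cs)

private
  opaque
    unfolding pair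

    pair-≥ : ∀ m n → m + n ≤ pair m n
    pair-≥ m n = ≤-trans (sq (m + n)) (m≤m+n _ m)
      where
        sq : ∀ s → s ≤ s * s
        sq zero    = z≤n
        sq (suc s) = m≤m*n (suc s) (suc s)

  pair-≥ˡ : ∀ m n → m ≤ pair m n
  pair-≥ˡ m n = ≤-trans (m≤m+n m n) (pair-≥ m n)

  pair-≥ʳ : ∀ m n → n ≤ pair m n
  pair-≥ʳ m n = ≤-trans (m≤n+m n m) (pair-≥ m n)

  drop : ∀ t n {k} → pair (suc t) n ≤ suc k → n ≤ k
  drop t n p = ≤-pred (≤-trans (≤-trans (s≤s (m≤n+m n t)) (pair-≥ (suc t) n)) p)

  nonzero : ∀ t n → pair (suc t) n ≤ 0 → ∀ {a} {A : Set a} → A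
  nonzero t n p = contradiction (≤-trans (pair-≥ˡ (suc t) n) p) λ ()

  open-code : ∀ k n t b → decode (suc k) n (pair t b) ≡ build k t n b
  open-code k n t b = cong₂ (λ t′ → build k t′ n) (fst-pair t b) (snd-pair t b)

encode-decode  : ∀ {n} (c : PR n) k → encode c ≤ k → decode k n (encode c) ≡ c
encodes-decode : ∀ {n m} (cs : Vec (PR n) m) k → encodes cs ≤ k → decodes k n m (encodes cs) ≡ cs

encode-decode succᶠ zero p = nonzero 0 _ p
encode-decode (proj i) zero p = nonzero 1 _ p
encode-decode (comp f gs) zero p = nonzero 2 _ p
encode-decode (prec g h) zero p = nonzero 3 _ p
encode-decode (min f) zero p = nonzero 4 _ p
encode-decode zeroᶠ zero _ = refl
encode-decode {n} zeroᶠ (suc k) _ = open-code k n 0 0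
encode-decode succᶠ (suc k) _ = open-code k 1 1 0
encode-decode {n} (proj i) (suc k) _ = trans (open-code k n 2 (toℕ i)) lem
  where
    lem : build k 2 n (toℕ i) ≡ proj i
    lem with toℕ i <? n
    ... | yes p = cong proj (fromℕ<-toℕ i p)
    ... | no ¬p = contradiction (toℕ<n i) ¬p
encode-decode {n} (comp {m = m} f gs) (suc k) p = trans (open-code k n 3 _) lem
  where
    b = pair m (pair (encode f) (encodes gs))
    q : pair (encode f) (encodes gs) ≤ k
    q = ≤-trans (pair-≥ʳ m _) (drop 2 b p)
    lem : build k 3 n b ≡ comp f gs
    lem = trans (cong₂ (λ a x → comp (decode k a (fst x)) (decodes k n a (snd x))) (fst-pair m _) (snd-pair m _))
         (trans (cong₂ (λ x y → comp (decode k m x) (decodes k n m y)) (fst-pair (encode f) _) (snd-pair (encode f) _))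
                (cong₂ comp (encode-decode f k (≤-trans (pair-≥ˡ _ _) q))
                            (encodes-decode gs k (≤-trans (pair-≥ʳ (encode f) _) q))))
encode-decode (prec {n} g h) (suc k) p = trans (open-code k (suc n) 4 _) lem
  where
    q = drop 3 (pair (encode g) (encode h)) p
    lem : build k 4 (suc n) (pair (encode g) (encode h)) ≡ prec g h
    lem = trans (cong₂ (λ x y → prec (decode k n x) (decode k (2 + n) y)) (fst-pair (encode g) _) (snd-pair (encode g) _))
                (cong₂ prec (encode-decode g k (≤-trans (pair-≥ˡ _ _) q))
                            (encode-decode h k (≤-trans (pair-≥ʳ (encode g) _) q)))
encode-decode {n} (min f) (suc k) p =
  trans (open-code k n 5 _) (cong min (encode-decode f k (drop 4 (encode f) p)))

encodes-decode [] k p = refl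
encodes-decode {n} {suc m} (c ∷ cs) k p =
  trans (cong₂ (λ x y → decode k n x ∷ decodes k n m y) (fst-pair (encode c) _) (snd-pair (encode c) _))
        (cong₂ _∷_ (encode-decode c k (≤-trans (pair-≥ˡ _ _) p))
                   (encodes-decode cs k (≤-trans (pair-≥ʳ (encode c) _) p)))

-- Abstract, since evaluating Gödel numbers of concrete programs is infeasible.
abstract
  index : PR 1 → ℕ
  index = encode

  program-index : ∀ c → program (index c) ≡ c
  program-index c = encode-decode c (encode c) ≤-refl

φ-index : ∀ {c n m} → c · n ∷ [] ⇓ m → φ (index c) n m
φ-index {c} {n} {m} = subst (λ d → d · n ∷ [] ⇓ m) (sym (program-index c))

private
  add mul monus : PR 2
  add   = prec (proj zero) (comp succᶠ (proj (suc zero) ∷ []))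
  mul   = prec zeroᶠ (comp add (proj (suc (suc zero)) ∷ proj (suc zero) ∷ []))
  monus = prec (proj zero) (comp (prec zeroᶠ (proj zero)) (proj (suc zero) ∷ []))

  ⇓add : ∀ m n → add · m ∷ n ∷ [] ⇓ m + n
  ⇓add zero    n = ⇓prec₀ (⇓proj zero)
  ⇓add (suc m) n = ⇓precₛ (⇓add m n) (⇓comp (⇓proj _ ∷ []) ⇓succ)

  ⇓mul : ∀ m n → mul · m ∷ n ∷ [] ⇓ m * n
  ⇓mul zero    n = ⇓prec₀ ⇓zero
  ⇓mul (suc m) n = ⇓precₛ (⇓mul m n) (⇓comp (⇓proj _ ∷ ⇓proj _ ∷ []) (⇓add n (m * n)))

  ⇓pred : ∀ n → prec zeroᶠ (proj zero) · n ∷ [] ⇓ Data.Nat.pred n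
  ⇓pred zero    = ⇓prec₀ ⇓zero
  ⇓pred (suc n) = ⇓precₛ (⇓pred n) (⇓proj zero)

  ⇓monus : ∀ n m → monus · n ∷ m ∷ [] ⇓ m ∸ n
  ⇓monus zero    m = ⇓prec₀ (⇓proj zero)
  ⇓monus (suc n) m = subst (monus · suc n ∷ m ∷ [] ⇓_) (pred[m∸n]≡m∸[1+n] m n)
                       (⇓precₛ (⇓monus n m) (⇓comp (⇓proj _ ∷ []) (⇓pred (m ∸ n))))

  rootTest : PR 2
  rootTest = comp monus (comp mul (comp succᶠ (proj zero ∷ []) ∷ comp succᶠ (proj zero ∷ []) ∷ [])
                         ∷ comp succᶠ (proj (suc zero) ∷ []) ∷ [])

  ⇓rootTest : ∀ s k → rootTest · s ∷ k ∷ [] ⇓ suc k ∸ suc s * suc s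
  ⇓rootTest s k =
    ⇓comp (⇓comp (⇓comp (⇓proj _ ∷ []) ⇓succ ∷ ⇓comp (⇓proj _ ∷ []) ⇓succ ∷ []) (⇓mul (suc s) (suc s))
           ∷ ⇓comp (⇓proj _ ∷ []) ⇓succ ∷ [])
          (⇓monus (suc s * suc s) (suc k))

  rootᶠ fstᶠ sndᶠ : PR 1
  rootᶠ = min rootTest
  fstᶠ  = comp monus (comp mul (rootᶠ ∷ rootᶠ ∷ []) ∷ proj zero ∷ [])
  sndᶠ  = comp monus (fstᶠ ∷ rootᶠ ∷ [])

  ⇓root : ∀ k → rootᶠ · k ∷ [] ⇓ root k
  ⇓root k = ⇓min (subst (rootTest · root k ∷ k ∷ [] ⇓_) (m≤n⇒m∸n≡0 (root-upper k)) (⇓rootTest (root k) k))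
                 λ i i<r → positive (⇓rootTest i k)
                   (m<n⇒0<n∸m (s≤s (≤-trans (*-mono-≤ i<r i<r) (root-lower k))))
    where
      positive : ∀ {i v} → rootTest · i ∷ k ∷ [] ⇓ v → 0 < v → ∃ λ z → rootTest · i ∷ k ∷ [] ⇓ suc z
      positive {v = suc z} p _ = z , p

  opaque
    unfolding pair fst

    ⇓fst : ∀ k → fstᶠ · k ∷ [] ⇓ fst k
    ⇓fst k = ⇓comp (⇓comp (⇓root k ∷ ⇓root k ∷ []) (⇓mul (root k) (root k)) ∷ ⇓proj zero ∷ [])
                   (⇓monus (root k * root k) k)

    ⇓snd : ∀ k → sndᶠ · k ∷ [] ⇓ snd k
    ⇓snd k = ⇓comp (⇓fst k ∷ ⇓root k ∷ []) (⇓monus (fst k) (root k))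

    pairᶠ : PR 1 → PR 1 → PR 1
    pairᶠ c d = comp add (comp mul (comp add (c ∷ d ∷ []) ∷ comp add (c ∷ d ∷ []) ∷ []) ∷ c ∷ [])

    ⇓pair : ∀ {c d n m k} → c · n ∷ [] ⇓ m → d · n ∷ [] ⇓ k → pairᶠ c d · n ∷ [] ⇓ pair m k
    ⇓pair {m = m} {k} p q =
      let r = ⇓comp (p ∷ q ∷ []) (⇓add m k)
      in ⇓comp (⇓comp (r ∷ r ∷ []) (⇓mul (m + k) (m + k)) ∷ p ∷ []) (⇓add ((m + k) * (m + k)) m)

φ-id : ∃ λ e → ∀ n → φ e n n
φ-id = index (proj zero) , λ n → φ-index (⇓proj zero)

φ-zero : ∃ λ e → ∀ n → φ e n 0
φ-zero = index zeroᶠ , λ n → φ-index ⇓zero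

φ-comp : ∀ d e → ∃ λ t → ∀ {n m k} → φ e n m → φ d m k → φ t n k
φ-comp d e = index (comp (program d) (program e ∷ [])) , λ p q → φ-index (⇓comp (p ∷ []) q)

φ-pair : ∀ d e → ∃ λ t → ∀ {n m k} → φ d n m → φ e n k → φ t n (pair m k)
φ-pair d e = index (pairᶠ (program d) (program e)) , λ p q → φ-index (⇓pair p q)

φ-fst : ∃ λ e → ∀ m n → φ e (pair m n) m
φ-fst = index fstᶠ , λ m n → φ-index (subst (fstᶠ · pair m n ∷ [] ⇓_) (fst-pair m n) (⇓fst (pair m n)))

φ-snd : ∃ λ e → ∀ m n → φ e (pair m n) n
φ-snd = index sndᶠ , λ m n → φ-index (subst (sndᶠ · pair m n ∷ [] ⇓_) (snd-pair m n) (⇓snd (pair m n)))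

-- A set is a setoid, and a subset of it is a predicate closed under the setoid equality.

record Assembly (ℓ : Level) : Set (lsuc ℓ) where
  field
    set : Setoid ℓ ℓ
  open Setoid set public
  field
    T      : Carrier → ℕ → Set ℓ
    T-resp : ∀ {x y n} → x ≈ y → T x n → T y n
    total  : ∀ x → ∃ λ n → T x n

module _ {ℓ : Level} where

  Tracks : (A B : Assembly ℓ) → ℕ → Func (Assembly.set A) (Assembly.set B) → Set ℓ
  Tracks A B t f = ∀ {x n} → Assembly.T A x n → ∃ λ m → φ t n m × Assembly.T B (f ⟨$⟩ x) m

  record AsmHom (A B : Assembly ℓ) : Set ℓ where
    field
      func    : Func (Assembly.set A) (Assembly.set B)
      tracked : ∃ λ t → Tracks A B t func
    open Func func public using (to) renaming (cong to to-cong)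

  open AsmHom using (to; to-cong; tracked)

  private
    realizedById : ∀ {A B} (f : Func (Assembly.set A) (Assembly.set B))
                 → (∀ {x n} → Assembly.T A x n → Assembly.T B (f ⟨$⟩ x) n) → AsmHom A B
    realizedById f u = record { func = f ; tracked = proj₁ φ-id , λ {_} {n} p → n , proj₂ φ-id n , u p }

    idAsm : ∀ {A : Assembly ℓ} → AsmHom A A
    idAsm = realizedById (idFunc _) (λ p → p)

    compAsm : ∀ {A B C : Assembly ℓ} → AsmHom B C → AsmHom A B → AsmHom A C
    compAsm g f = record
      { func    = compFunc (AsmHom.func f) (AsmHom.func g)
      ; tracked = proj₁ gf , λ p →
          let m , q , r = proj₂ (tracked f) p
              k , u , v = proj₂ (tracked g) r
          in k , proj₂ gf q u , v }
      where gf = φ-comp (proj₁ (tracked g)) (proj₁ (tracked f))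

  Asm : Category (lsuc ℓ) ℓ ℓ
  Asm = record
    { Obj       = Assembly ℓ
    ; _⇒_       = AsmHom
    ; _≈_       = λ {A} {B} f g → ∀ x → Assembly._≈_ B (to f x) (to g x)
    ; id        = idAsm
    ; _∘_       = compAsm
    ; assoc     = λ {_} {_} {_} {D} x → Assembly.refl D
    ; identityˡ = λ {_} {B} x → Assembly.refl B
    ; identityʳ = λ {_} {B} x → Assembly.refl B
    ; equiv     = λ {_} {B} → record
        { refl  = λ x → Assembly.refl B
        ; sym   = λ p x → Assembly.sym B (p x)
        ; trans = λ p q x → Assembly.trans B (p x) (q x) }
    ; ∘-resp-≈  = λ {_} {_} {C} {f} {f′} {g} {g′} p q x → Assembly.trans C (to-cong f (q x)) (p (to g′ x))
    }

  -- Together with totality, this says that the relation T is a function.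
  Partitioned : Assembly ℓ → Set ℓ
  Partitioned A = ∀ {x n m} → T x n → T x m → n ≡ m
    where open Assembly A

  PAsm : Category (lsuc ℓ) ℓ ℓ
  PAsm = FullSubcategory Asm {I = Σ (Assembly ℓ) Partitioned} proj₁

  private
    module Asm = Category Asm

    unitAsm : Assembly ℓ
    unitAsm = record
      { set    = record { Carrier = ⊤ ; _≈_ = λ _ _ → ⊤ ; isEquivalence = record { refl = tt ; sym = λ _ → tt ; trans = λ _ _ → tt } }
      ; T      = λ _ n → Lift ℓ (n ≡ 0)
      ; T-resp = λ _ p → p
      ; total  = λ _ → 0 , lift refl
      }

    _×A_ : Assembly ℓ → Assembly ℓ → Assembly ℓ
    A ×A B = record
      { set    = record
          { Carrier       = A.Carrier × B.Carrier
          ; _≈_           = λ (x , y) (x′ , y′) → x A.≈ x′ × y B.≈ y′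
          ; isEquivalence = record
              { refl  = A.refl , B.refl
              ; sym   = λ (p , q) → A.sym p , B.sym q
              ; trans = λ (p , q) (p′ , q′) → A.trans p p′ , B.trans q q′ } }
      ; T      = λ (x , y) k → ∃ λ m → ∃ λ n → k ≡ pair m n × A.T x m × B.T y n
      ; T-resp = λ (p , q) (m , n , e , u , v) → m , n , e , A.T-resp p u , B.T-resp q v
      ; total  = λ (x , y) →
          let m , u = A.total x
              n , v = B.total y
          in pair m n , m , n , refl , u , v
      }
      where
        module A = Assembly A
        module B = Assembly B

    fstA : ∀ {A B} → AsmHom (A ×A B) A
    fstA = record
      { func    = record { to = proj₁ ; cong = proj₁ }
      ; tracked = proj₁ φ-fst , λ { (m , n , refl , u , v) → m , proj₂ φ-fst m n , u } }

    sndA : ∀ {A B} → AsmHom (A ×A B) B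
    sndA = record
      { func    = record { to = proj₂ ; cong = proj₂ }
      ; tracked = proj₁ φ-snd , λ { (m , n , refl , u , v) → n , proj₂ φ-snd m n , v } }

    pairA : ∀ {A B X} → AsmHom X A → AsmHom X B → AsmHom X (A ×A B)
    pairA f g = record
      { func    = record { to = λ x → to f x , to g x ; cong = λ p → to-cong f p , to-cong g p }
      ; tracked = proj₁ fg , λ p →
          let m , q , u = proj₂ (tracked f) p
              n , r , v = proj₂ (tracked g) p
          in pair m n , proj₂ fg q r , m , n , refl , u , v }
      where fg = φ-pair (proj₁ (tracked f)) (proj₁ (tracked g))

    ×-partitioned : ∀ {A B} → Partitioned A → Partitioned B → Partitioned (A ×A B)
    ×-partitioned p q (m , n , refl , u , v) (m′ , n′ , refl , u′ , v′) = cong₂ pair (p u u′) (q v v′)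

  PAsm-products : FiniteProducts PAsm
  PAsm-products = record
    { 𝟙        = unitAsm , λ { (lift refl) (lift refl) → refl }
    ; !        = record
        { func    = record { to = λ _ → tt ; cong = λ _ → tt }
        ; tracked = proj₁ φ-zero , λ {_} {n} _ → 0 , proj₂ φ-zero n , lift refl }
    ; !-unique = λ f x → tt
    ; _⊗_      = λ (A , p) (B , q) → (A ×A B) , ×-partitioned {A} {B} p q
    ; π₁       = fstA
    ; π₂       = sndA
    ; ⟨_,_⟩    = pairA
    ; project₁ = λ {(A , _)} x → Assembly.refl A
    ; project₂ = λ {_} {(B , _)} x → Assembly.refl B
    ; unique   = λ {(A , _)} {(B , _)} p q x → Assembly.sym A (p x) , Assembly.sym B (q x)
    }

  record Subset (A : Assembly ℓ) : Set (lsuc ℓ) where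
    open Assembly A
    field
      mem  : Carrier → Set ℓ
      resp : ∀ {x y} → x ≈ y → mem x → mem y

  open Subset using (mem; resp)

  _⊆_ : ∀ {A} → Rel (Subset A) ℓ
  X ⊆ Y = ∀ x → mem X x → mem Y x

  _∩_ : ∀ {A} → Subset A → Subset A → Subset A
  X ∩ Y = record { mem = λ x → mem X x × mem Y x ; resp = λ p (u , v) → resp X p u , resp Y p v }

  full : ∀ {A} → Subset A
  full = record { mem = λ _ → ⊤ ; resp = λ _ _ → tt }

  preimage : ∀ {A B} → AsmHom A B → Subset B → Subset A
  preimage f X = record { mem = λ x → mem X (to f x) ; resp = λ p → resp X (to-cong f p) }

  Powerset : Assembly ℓ → BoundedMeetSemilattice (lsuc ℓ) ℓ ℓ
  Powerset A = record
    { Carrier = Subset A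
    ; _≈_     = λ X Y → X ⊆ Y × Y ⊆ X
    ; _≤_     = _⊆_
    ; _∧_     = _∩_
    ; ⊤       = full
    ; isBoundedMeetSemilattice = record
        { isMeetSemilattice = record
            { isPartialOrder = record
                { isPreorder = record
                    { isEquivalence = record
                        { refl  = (λ _ u → u) , (λ _ u → u)
                        ; sym   = swap
                        ; trans = λ (p , q) (p′ , q′) → (λ x u → p′ x (p x u)) , (λ x u → q x (q′ x u)) }
                    ; reflexive = proj₁
                    ; trans     = λ p q x u → q x (p x u) }
                ; antisym = λ p q → p , q }
            ; infimum = λ X Y → (λ _ → proj₁) , (λ _ → proj₂) , λ Z p q x u → p x u , q x u }
        ; maximum = λ X x u → tt }
    }

  PΓ-doctrine : Doctrine PAsm (lsuc ℓ) ℓ ℓ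
  PΓ-doctrine = record { functor = record
    { F₀           = λ (A , _) → Powerset A
    ; F₁           = λ f → record
        { ⟦_⟧    = preimage f
        ; mono   = λ p x → p (to f x)
        ; ∧-homo = λ X Y → (λ _ u → u) , (λ _ u → u)
        ; ⊤-homo = (λ _ u → u) , (λ _ u → u) }
    ; identity     = λ X → (λ _ u → u) , (λ _ u → u)
    ; homomorphism = λ X → (λ _ u → u) , (λ _ u → u)
    ; F-resp-≈     = λ {(B , _)} p X → (λ x → resp X (p x)) , (λ x → resp X (Assembly.sym B (p x)))
    } }

  PΓ : ElementaryDoctrine PAsm (lsuc ℓ) ℓ ℓ
  PΓ = record
    { products  = PAsm-products
    ; doctrine  = PΓ-doctrine
    ; δ         = λ (A , _) → let module A = Assembly A in record
        { mem  = λ (x , y) → x A.≈ y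
        ; resp = λ (p , q) r → A.trans (A.sym p) (A.trans r q) }
    ; δ-adjoint = λ {(X , _)} {(A , _)} α β → mk⇔
        (λ p (x , a) u → p ((x , a) , a) (u , Assembly.refl A))
        (λ p ((x , a) , a′) (u , a≈a′) → resp β ((Assembly.refl X , Assembly.refl A) , a≈a′) (p (x , a) u))
    }

  restrict : (A : Assembly ℓ) → Subset A → Assembly ℓ
  restrict A X = record
    { set    = record
        { Carrier       = Σ A.Carrier (mem X)
        ; _≈_           = λ (x , _) (y , _) → x A.≈ y
        ; isEquivalence = record { refl = A.refl ; sym = A.sym ; trans = A.trans } }
    ; T      = λ (x , _) n → A.T x n
    ; T-resp = A.T-resp
    ; total  = λ (x , _) → A.total x
    }
    where module A = Assembly A

  inclusion : ∀ {A} (X : Subset A) → AsmHom (restrict A X) A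
  inclusion X = realizedById (record { to = proj₁ ; cong = λ p → p }) (λ p → p)

  record StrongSubobject (A : Assembly ℓ) : Set (lsuc ℓ) where
    open Category Asm
    field
      dom    : Assembly ℓ
      arr    : dom ⇒ A
      subset : Subset A
      iso    : dom ⇒ restrict A subset
      iso⁻¹  : restrict A subset ⇒ dom
      isoˡ   : iso⁻¹ ∘ iso ≈ id
      isoʳ   : iso ∘ iso⁻¹ ≈ id
      over   : inclusion subset ∘ iso ≈ arr

  open StrongSubobject using (dom; arr; subset; iso; iso⁻¹; isoˡ; isoʳ; over)

  _≤ˢ_ : ∀ {A} → Rel (StrongSubobject A) ℓ
  S ≤ˢ S′ = Σ (dom S ⇒ dom S′) λ h → arr S′ ∘ h ≈ arr S
    where open Category Asm

  pullbackAsm : ∀ {X Y Z : Assembly ℓ} (f : AsmHom X Z) (g : AsmHom Y Z) → Pullback Asm f g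
  pullbackAsm {X} {Y} {Z} f g = record
    { P         = restrict (X ×A Y) fibred
    ; p₁        = compAsm fstA (inclusion fibred)
    ; p₂        = compAsm sndA (inclusion fibred)
    ; commute   = proj₂
    ; universal = λ u v eq → record
        { func    = record { to = λ w → (to u w , to v w) , eq w ; cong = λ p → to-cong u p , to-cong v p }
        ; tracked = tracked (pairA u v) }
    ; p₁∘universal = λ _ → Assembly.refl X
    ; p₂∘universal = λ _ → Assembly.refl Y
    ; unique    = λ p q w → p w , q w
    }
    where
      module Z = Assembly Z
      fibred : Subset (X ×A Y)
      fibred = record
        { mem  = λ (x , y) → to f x Z.≈ to g y
        ; resp = λ (p , q) r → Z.trans (Z.sym (to-cong f p)) (Z.trans r (to-cong g q)) }

  arr∈ : ∀ {A} (S : StrongSubobject A) s → mem (subset S) (to (arr S) s)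
  arr∈ S s = resp (subset S) (over S s) (proj₂ (to (iso S) s))

  over⁻¹ : ∀ {A} (S : StrongSubobject A) x → Assembly._≈_ A (to (arr S) (to (iso⁻¹ S) x)) (proj₁ x)
  over⁻¹ {A} S x = A.trans (A.sym (over S (to (iso⁻¹ S) x))) (isoʳ S x)
    where module A = Assembly A

  arr-injective : ∀ {A} (S : StrongSubobject A) {s s′}
                → Assembly._≈_ A (to (arr S) s) (to (arr S) s′) → Assembly._≈_ (dom S) s s′
  arr-injective {A} S {s} {s′} p =
    D.trans (D.sym (isoˡ S s)) (D.trans (to-cong (iso⁻¹ S) (A.trans (over S s) (A.trans p (A.sym (over S s′))))) (isoˡ S s′))
    where
      module A = Assembly A
      module D = Assembly (dom S)

  ⊆⇒≤ˢ : ∀ {A} (S S′ : StrongSubobject A) → subset S ⊆ subset S′ → S ≤ˢ S′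
  ⊆⇒≤ˢ {A} S S′ p = (iso⁻¹ S′ ∘ k ∘ iso S) , λ s → Assembly.trans A (over⁻¹ S′ (to (k ∘ iso S) s)) (over S s)
    where
      open Category Asm using (_∘_)
      k : AsmHom (restrict A (subset S)) (restrict A (subset S′))
      k = realizedById (record { to = λ (x , u) → x , p x u ; cong = λ q → q }) (λ q → q)

  ≤ˢ⇒⊆ : ∀ {A} (S S′ : StrongSubobject A) → S ≤ˢ S′ → subset S ⊆ subset S′
  ≤ˢ⇒⊆ {A} S S′ (h , p) x u =
    resp (subset S′) (Assembly.trans A (p s) (over⁻¹ S (x , u))) (arr∈ S′ (to h s))
    where s = to (iso⁻¹ S) (x , u)

  pullbackˢ : ∀ {A B} → AsmHom A B → StrongSubobject B → StrongSubobject A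
  pullbackˢ {A} {B} f S = record
    { dom    = P
    ; arr    = p₁
    ; subset = preimage f (subset S)
    ; iso    = record
        { func    = record
            { to   = λ w → to p₁ w , resp (subset S) (Assembly.sym B (commute w)) (arr∈ S (to p₂ w))
            ; cong = λ {w} {w′} → to-cong p₁ {w} {w′} }
        ; tracked = tracked p₁ }
    ; iso⁻¹  = universal incl (iso⁻¹ S ∘ f∣) (λ x → Assembly.sym B (over⁻¹ S (to f∣ x)))
    ; isoˡ   = λ w → Assembly.refl A ,
        arr-injective S (Assembly.trans B (over⁻¹ S (to f (to p₁ w) , _)) (commute w))
    ; isoʳ   = λ x → Assembly.refl A
    ; over   = λ w → Assembly.refl A
    }
    where
      open Pullback (pullbackAsm f (arr S))
      open Category Asm using (_∘_)
      incl = inclusion (preimage f (subset S))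
      f∣ : AsmHom (restrict A (preimage f (subset S))) (restrict B (subset S))
      f∣ = record
        { func    = record { to = λ (x , u) → to f x , u ; cong = to-cong f }
        ; tracked = proj₁ (tracked f) , λ p → proj₂ (tracked f) p }

  -- The meet of S and S′ is the pullback of S′ along arr S, composed with arr S.
  _∩ˢ_ : ∀ {A} → StrongSubobject A → StrongSubobject A → StrongSubobject A
  _∩ˢ_ {A} S S′ = record
    { dom    = dom R
    ; arr    = arr S ∘ arr R
    ; subset = subset S ∩ subset S′
    ; iso    = record
        { func    = record
            { to   = λ w → to (arr S ∘ arr R) w , arr∈ S (to (arr R) w) , arr∈R w
            ; cong = λ {w} {w′} → to-cong (arr S ∘ arr R) {w} {w′} }
        ; tracked = tracked (arr S ∘ arr R) }
    ; iso⁻¹  = iso⁻¹ R ∘ k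
    ; isoˡ   = λ w → let x = to (arr S ∘ arr R) w , arr∈ S (to (arr R) w) in
        arr-injective R {to (iso⁻¹ R ∘ k) (proj₁ x , proj₂ x , arr∈R w)} {w}
          (Assembly.trans (dom S) (over⁻¹ R (to k (proj₁ x , proj₂ x , arr∈R w)))
                                  (arr-injective S (over⁻¹ S x)))
    ; isoʳ   = λ (x , u , v) → Assembly.trans A (to-cong (arr S) (over⁻¹ R (to k (x , u , v)))) (over⁻¹ S (x , u))
    ; over   = λ w → Assembly.refl A
    }
    where
      open Category Asm using (_∘_)
      R = pullbackˢ (arr S) S′
      arr∈R : ∀ w → mem (subset S′) (to (arr S ∘ arr R) w)
      arr∈R = arr∈ R
      k : AsmHom (restrict A (subset S ∩ subset S′)) (restrict (dom S) (subset R))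
      k = record
        { func    = record
            { to   = λ (x , u , v) → to (iso⁻¹ S) (x , u) , resp (subset S′) (Assembly.sym A (over⁻¹ S (x , u))) v
            ; cong = to-cong (iso⁻¹ S) }
        ; tracked = proj₁ (tracked (iso⁻¹ S)) , λ {(x , u , _)} p → proj₂ (tracked (iso⁻¹ S)) {x , u} p }

  fullˢ : ∀ {A} → StrongSubobject A
  fullˢ {A} = record
    { dom    = A
    ; arr    = id
    ; subset = full
    ; iso    = realizedById (record { to = λ x → x , tt ; cong = λ p → p }) (λ p → p)
    ; iso⁻¹  = inclusion full
    ; isoˡ   = λ x → Assembly.refl A
    ; isoʳ   = λ x → Assembly.refl A
    ; over   = λ x → Assembly.refl A
    }
    where open Category Asm using (id)

  StrongSubobjects : Assembly ℓ → BoundedMeetSemilattice (lsuc ℓ) ℓ ℓ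
  StrongSubobjects A = record
    { Carrier = StrongSubobject A
    ; _≈_     = λ S S′ → S ≤ˢ S′ × S′ ≤ˢ S
    ; _≤_     = _≤ˢ_
    ; _∧_     = _∩ˢ_
    ; ⊤       = fullˢ
    ; isBoundedMeetSemilattice = record
        { isMeetSemilattice = record
            { isPartialOrder = record
                { isPreorder = record
                    { isEquivalence = record
                        { refl  = λ {S} → ≤-reflˢ S , ≤-reflˢ S
                        ; sym   = swap
                        ; trans = λ {R} {S} {S′} (p , q) (p′ , q′) → ≤-transˢ R S S′ p p′ , ≤-transˢ S′ S R q′ q }
                    ; reflexive = proj₁
                    ; trans     = λ {R} {S} {S′} → ≤-transˢ R S S′ }
                ; antisym = λ p q → p , q }
            ; infimum = λ S S′ → ⊆⇒≤ˢ (S ∩ˢ S′) S (λ _ → proj₁) , ⊆⇒≤ˢ (S ∩ˢ S′) S′ (λ _ → proj₂) ,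
                λ R p q → ⊆⇒≤ˢ R (S ∩ˢ S′) (λ x u → ≤ˢ⇒⊆ R S p x u , ≤ˢ⇒⊆ R S′ q x u) }
        ; maximum = λ S → ⊆⇒≤ˢ S fullˢ (λ _ _ → tt) }
    }
    where
      ≤-reflˢ : (S : StrongSubobject A) → S ≤ˢ S
      ≤-reflˢ S = ⊆⇒≤ˢ S S (λ _ u → u)

      ≤-transˢ : (R S S′ : StrongSubobject A) → R ≤ˢ S → S ≤ˢ S′ → R ≤ˢ S′
      ≤-transˢ R S S′ p q = ⊆⇒≤ˢ R S′ (λ x u → ≤ˢ⇒⊆ S S′ q x (≤ˢ⇒⊆ R S p x u))

  Ssb : Doctrine Asm (lsuc ℓ) ℓ ℓ
  Ssb = record { functor = record
    { F₀           = StrongSubobjects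
    ; F₁           = λ f → record
        { ⟦_⟧    = pullbackˢ f
        ; mono   = λ {S} {S′} p → ⊆⇒≤ˢ (pullbackˢ f S) (pullbackˢ f S′) (λ x → ≤ˢ⇒⊆ S S′ p (to f x))
        ; ∧-homo = λ S S′ → ⊆⇒≈ˢ (pullbackˢ f (S ∩ˢ S′)) (pullbackˢ f S ∩ˢ pullbackˢ f S′) (λ _ u → u) (λ _ u → u)
        ; ⊤-homo = ⊆⇒≈ˢ (pullbackˢ f fullˢ) fullˢ (λ _ u → u) (λ _ u → u) }
    ; identity     = λ S → ⊆⇒≈ˢ (pullbackˢ id S) S (λ _ u → u) (λ _ u → u)
    ; homomorphism = λ {_} {_} {_} {g} {f} S →
        ⊆⇒≈ˢ (pullbackˢ (g ∘ f) S) (pullbackˢ f (pullbackˢ g S)) (λ _ u → u) (λ _ u → u)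
    ; F-resp-≈     = λ {B} {_} {f} {g} p S → ⊆⇒≈ˢ (pullbackˢ f S) (pullbackˢ g S)
        (λ x → resp (subset S) (p x)) (λ x → resp (subset S) (Assembly.sym B (p x)))
    } }
    where
      open Category Asm using (id; _∘_)
      ⊆⇒≈ˢ : ∀ {A} (S S′ : StrongSubobject A) → subset S ⊆ subset S′ → subset S′ ⊆ subset S
            → S ≤ˢ S′ × S′ ≤ˢ S
      ⊆⇒≈ˢ S S′ p q = ⊆⇒≤ˢ S S′ p , ⊆⇒≤ˢ S′ S q

-- The axiom of choice for sets: every total relation between sets contains
-- the graph of a function. It holds for classical sets, but Agda does not
-- derive it for setoids, where the choice must respect equality.

AxiomOfChoice : (ℓ : Level) → Set (lsuc ℓ)
AxiomOfChoice ℓ =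
  (A B : Setoid ℓ ℓ) →
  let module A = Setoid A
      module B = Setoid B
  in (R : A.Carrier → B.Carrier → Set ℓ) →
     (∀ {a a′ b b′} → a A.≈ a′ → b B.≈ b′ → R a b → R a′ b′) →
     (∀ a → ∃ λ b → R a b) →
     Σ (Func A B) λ f → ∀ a → R a (f ⟨$⟩ a)

{-# OPTIONS --safe #-}

-- A pair (A , ρ) is sent to the quotient assembly A/ρ, where n realizes x when n is the code
-- of some x′ with ρ(x , x′). An assembly (P , T) is sent to the partitioned assembly of pairs
-- (x , n) with x T n, coded by n, together with the kernel of the projection to P. On predicates,
-- a descent datum on (A , ρ) is the same thing as a subset of A/ρ. Choice enters only in the
-- arrow from the cover of A/ρ back to A: for each (x , n) it picks an x′ with ρ(x , x′) coded by n.
module Submission where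

open import Level using (Level; Lift; lift)
open import Data.Product using (Σ; ∃; _×_; _,_; proj₁; proj₂)
open import Function using (Func; _⟨$⟩_)
open import Relation.Binary.Lattice using (BoundedMeetSemilattice)
open import Relation.Binary.PropositionalEquality using (_≡_; refl; sym; trans)
open import Defs

module _ {ℓ : Level} where

  open QuotientCompletion (PΓ {ℓ})
  open QuotientCompletion.QObj
  open QuotientCompletion.QHom using (arr; ext)
  open QuotientCompletion.Descent using (pred; descent)
  open AsmHom using (to; to-cong; tracked)
  open Subset using (mem; resp)
  open StrongSubobject using (subset)

  trackedById : ∀ {A B : Assembly ℓ} (f : Func (Assembly.set A) (Assembly.set B))
              → (∀ {x n} → Assembly.T A x n → Assembly.T B (f ⟨$⟩ x) n) → AsmHom A B
  trackedById f u = record { func = f ; tracked = proj₁ φ-id , λ {_} {n} p → n , proj₂ φ-id n , u p }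

  strongSubobject : ∀ {A : Assembly ℓ} → Subset A → StrongSubobject A
  strongSubobject {A} X = record
    { dom    = restrict A X
    ; arr    = inclusion X
    ; subset = X
    ; iso    = id
    ; iso⁻¹  = id
    ; isoˡ   = λ _ → Assembly.refl A
    ; isoʳ   = λ _ → Assembly.refl A
    ; over   = λ _ → Assembly.refl A
    }
    where open Category Asm using (id)

  ⊆-antisymˢ : ∀ {A : Assembly ℓ} (S S′ : StrongSubobject A)
             → subset S ⊆ subset S′ → subset S′ ⊆ subset S → S ≤ˢ S′ × S′ ≤ˢ S
  ⊆-antisymˢ S S′ p q = ⊆⇒≤ˢ S S′ p , ⊆⇒≤ˢ S′ S q

  -- The quotient functor.

  quotient : QObj → Assembly ℓ
  quotient A = record
    { set    = record
        { Carrier       = A₀.Carrier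
        ; _≈_           = λ x y → mem (rel A) (x , y)
        ; isEquivalence = record
            { refl  = λ {x} → reflexive A (x , x) A₀.refl
            ; sym   = λ {x} {y} → symmetric A (x , y)
            ; trans = ρ-trans } }
    -- The carrier stays that of A and only its equality is coarsened to ρ, so codes must be
    -- saturated under ρ for `T-resp` to hold.
    ; T      = λ x n → ∃ λ x′ → mem (rel A) (x , x′) × A₀.T x′ n
    ; T-resp = λ {x} {y} p (x′ , q , u) → x′ , ρ-trans (symmetric A (x , y) p) q , u
    ; total  = λ x → let n , u = A₀.total x in n , x , reflexive A (x , x) A₀.refl , u
    }
    where
      module A₀ = Assembly (proj₁ (obj A))
      ρ-trans : ∀ {x y z} → mem (rel A) (x , y) → mem (rel A) (y , z) → mem (rel A) (x , z)
      ρ-trans {x} {y} {z} p q = transitive A ((x , y) , z) (p , q)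

  quotientMap : ∀ {A B} → QHom A B → AsmHom (quotient A) (quotient B)
  quotientMap f = record
    { func    = record { to = to (arr f) ; cong = λ {x} {y} → ext f (x , y) }
    -- The tracker of `arr f` still works: it runs on a code of x′, and `ext` carries ρ(x , x′) to
    -- the images.
    ; tracked = proj₁ (tracked (arr f)) , λ {x} (x′ , p , u) →
        let m , q , v = proj₂ (tracked (arr f)) u
        in m , q , to (arr f) x′ , ext f (x , x′) p , v }

  Quotient : Functor Q (Asm {ℓ})
  Quotient = record
    { F₀           = quotient
    ; F₁           = quotientMap
    ; identity     = λ {A} _ → Assembly.refl (quotient A)
    ; homomorphism = λ {_} {_} {C} _ → Assembly.refl (quotient C)
    -- Restricting `f ∼ g` to the diagonal gives pointwise equality in the quotient.
    ; F-resp-≈     = λ {A} p x → p (x , x) (Assembly.refl (quotient A))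
    }

  -- Partitioned covers and the kernel functor.

  cover : Assembly ℓ → Assembly ℓ
  cover A = record
    { set    = record
        { Carrier       = Σ A.Carrier λ x → ∃ λ n → A.T x n
        -- Codes are compared so that `T-resp` holds; different evidence for x T n gives the same
        -- point.
        ; _≈_           = λ (x , n , _) (y , m , _) → x A.≈ y × n ≡ m
        ; isEquivalence = record
            { refl  = A.refl , refl
            ; sym   = λ (p , q) → A.sym p , sym q
            ; trans = λ (p , q) (p′ , q′) → A.trans p p′ , trans q q′ } }
    ; T      = λ (_ , n , _) m → Lift ℓ (m ≡ n)
    ; T-resp = λ { (_ , q) (lift e) → lift (trans e q) }
    ; total  = λ (_ , n , _) → n , lift refl
    }
    where module A = Assembly A

  cover-partitioned : (A : Assembly ℓ) → Partitioned (cover A)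
  cover-partitioned A (lift p) (lift q) = trans p (sym q)

  kernel : Assembly ℓ → QObj
  kernel A = record
    { obj   = cover A , λ {x} → cover-partitioned A {x}
    ; rel   = record
        { mem  = λ ((x , _) , (y , _)) → x A.≈ y
        ; resp = λ ((p , _) , (q , _)) r → A.trans (A.sym p) (A.trans r q) }
    ; isEqv = record
        { reflexive  = λ _ → proj₁
        ; symmetric  = λ _ → A.sym
        ; transitive = λ _ (p , q) → A.trans p q }
    }
    where module A = Assembly A

  -- The lift of f to the covers depends on the chosen tracker, but the kernel relation ignores
  -- codes, so all such lifts are one arrow of `Q`. This gives functoriality.
  kernelMap : ∀ {A B} → AsmHom A B → QHom (kernel A) (kernel B)
  kernelMap f = record
    { arr = record
        { func    = record
            { to   = λ (x , _ , u) → let m , _ , v = proj₂ (tracked f) u in to f x , m , v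
            -- The output of the tracker could depend on the evidence u; single-valuedness of φ
            -- rules this out.
            ; cong = λ { {_ , _ , u} {_ , _ , u′} (p , refl) →
                to-cong f p , φ-functional {proj₁ (tracked f)} (proj₁ (proj₂ (proj₂ (tracked f) u)))
                                                             (proj₁ (proj₂ (proj₂ (tracked f) u′))) } }
        ; tracked = proj₁ (tracked f) , λ { {_ , _ , u} (lift refl) →
            let m , q , _ = proj₂ (tracked f) u in m , q , lift refl } }
    ; ext = λ _ → to-cong f
    }

  Kernel : Functor (Asm {ℓ}) Q
  Kernel = record
    { F₀           = kernel
    ; F₁           = kernelMap
    ; identity     = λ _ p → p
    ; homomorphism = λ {_} {_} {_} {f} {g} _ p → to-cong g (to-cong f p)
    ; F-resp-≈     = λ {_} {B} {f} {g} p (_ , (y , _)) q → Assembly.trans B (to-cong f q) (p y)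
    }

  -- Comparison maps that need no choice.

  kernel-quotient-η : ∀ A → QHom A (kernel (quotient A))
  kernel-quotient-η A = record
    { arr = record
        { func    = record
            { to   = λ x → x , Assembly.total (quotient A) x
            -- `proj₂ (obj A)` is partitionedness: equal points share their only code, so the codes
            -- supplied by `total` agree.
            ; cong = λ {x} {y} p → reflexive A (x , y) p
                   , proj₂ (obj A) (A₀.T-resp p (proj₂ (A₀.total x))) (proj₂ (A₀.total y)) }
        -- The code attached to x is its only code, hence the identity tracks.
        ; tracked = proj₁ φ-id , λ {x} {n} u →
            n , proj₂ φ-id n , lift (proj₂ (obj A) u (proj₂ (A₀.total x))) }
    ; ext = λ _ p → p
    }
    where module A₀ = Assembly (proj₁ (obj A))

  quotient-kernel-ε : ∀ A → AsmHom (quotient (kernel A)) A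
  quotient-kernel-ε A = trackedById (record { to = proj₁ ; cong = λ p → p })
    λ { ((_ , _ , u) , p , lift refl) → A.T-resp (A.sym p) u }
    where module A = Assembly A

  quotient-kernel-ε⁻¹ : ∀ A → AsmHom A (quotient (kernel A))
  quotient-kernel-ε⁻¹ A = trackedById (record { to = λ x → x , A.total x ; cong = λ p → p })
    -- The code chosen by `total` may differ from n, but (x , n , u) lies in the same kernel class
    -- and has code n.
    λ {x} {n} u → (x , n , u) , A.refl , lift refl
    where module A = Assembly A

  quotient-kernel : NaturalIsomorphism (Quotient ∘F Kernel) idF
  quotient-kernel = record
    { to   = record { η = quotient-kernel-ε ; commute = λ {_} {B} _ _ → Assembly.refl B }
    ; from = record { η = quotient-kernel-ε⁻¹ ; commute = λ {_} {B} _ _ → Assembly.refl B }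
    ; isoˡ = λ A _ → Assembly.refl A
    ; isoʳ = λ A _ → Assembly.refl A
    }

  -- Action on predicates.

  quotientFibre : ∀ A → MeetHom (Doctrine.F₀ P̄ A) (StrongSubobjects (quotient A))
  quotientFibre A = record
    { ⟦_⟧    = λ α → strongSubobject (image α)
    ; mono   = λ {α} {β} → ⊆⇒≤ˢ (strongSubobject (image α)) (strongSubobject (image β))
    ; ∧-homo = λ α β → ⊆-antisymˢ
        (strongSubobject (image (α ∧ β)))
        (strongSubobject (image α) ∩ˢ strongSubobject (image β))
        (λ _ u → u) (λ _ u → u)
    ; ⊤-homo = ⊆-antisymˢ (strongSubobject (image ⊤)) fullˢ (λ _ u → u) (λ _ u → u)
    }
    where
      open BoundedMeetSemilattice (Doctrine.F₀ P̄ A) using (_∧_; ⊤)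
      image : Descent A → Subset (quotient A)
      image α = record { mem = mem (pred α) ; resp = λ {x} {y} p u → descent α (x , y) (u , p) }

  QuotientD : DoctrineMorphism P̄ Ssb
  QuotientD = record
    { base  = Quotient
    ; fibre = record
        { η       = quotientFibre
        ; commute = λ {A} {B} f α → ⊆-antisymˢ
            (MeetHom.⟦_⟧ (quotientFibre B) (MeetHom.⟦_⟧ (Doctrine.F₁ P̄ f) α))
            (pullbackˢ (quotientMap f) (MeetHom.⟦_⟧ (quotientFibre A) α))
            (λ _ u → u) (λ _ u → u) }
    }

  kernelFibre : ∀ A → MeetHom (StrongSubobjects A) (Doctrine.F₀ P̄ (kernel A))
  kernelFibre A = record
    { ⟦_⟧    = λ S → record
        { pred    = record
            { mem  = λ (x , _) → mem (subset S) x
            ; resp = λ (p , _) → resp (subset S) p }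
        -- Membership and the kernel relation both look only at the point of A, never at its code.
        ; descent = λ _ (u , p) → resp (subset S) p u }
    ; mono   = λ {S} {S′} p (x , _) → ≤ˢ⇒⊆ S S′ p x
    ; ∧-homo = λ _ _ → (λ _ u → u) , (λ _ u → u)
    ; ⊤-homo = (λ _ u → u) , (λ _ u → u)
    }

  KernelD : DoctrineMorphism Ssb P̄
  KernelD = record
    { base  = Kernel
    ; fibre = record
        { η       = kernelFibre
        ; commute = λ _ _ → (λ _ u → u) , (λ _ u → u) }
    }

  quotient-kernelD : DoctrineIsomorphism (QuotientD ∘D KernelD) idD
  quotient-kernelD = record
    { to   = record
        { θ   = quotient-kernel.to
        ; lax = λ A S → ⊆⇒≤ˢ (QK.fibre₀ A S) (pullbackˢ (quotient-kernel-ε A) S) (λ _ u → u) }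
    ; from = record
        { θ   = quotient-kernel.from
        ; lax = λ A S → ⊆⇒≤ˢ S (pullbackˢ (quotient-kernel-ε⁻¹ A) (QK.fibre₀ A S)) (λ _ u → u) }
    ; isoˡ = quotient-kernel.isoˡ
    ; isoʳ = quotient-kernel.isoʳ
    }
    where
      module quotient-kernel = NaturalIsomorphism quotient-kernel
      module QK = DoctrineMorphism (QuotientD ∘D KernelD)

  -- The inverse of the unit, from choice.

  module _ (choice : AxiomOfChoice ℓ) where

    private
      module Represent (A : QObj) where
        module A₀ = Assembly (proj₁ (obj A))
        module A/ρ = Assembly (quotient A)

        -- Each point w already contains a suitable x′, but equality in the cover ignores it, so
        -- projecting it out need not respect equality. Choice supplies a selection that does.
        representative : Σ (Func (Assembly.set (cover (quotient A))) A₀.set)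
                           λ f → ∀ w → mem (rel A) (proj₁ w , f ⟨$⟩ w) × A₀.T (f ⟨$⟩ w) (proj₁ (proj₂ w))
        representative = choice (Assembly.set (cover (quotient A))) A₀.set
          (λ (x , n , _) x′ → mem (rel A) (x , x′) × A₀.T x′ n)
          (λ { {b = b} {b′} (p , refl) q (r , u) →
              A/ρ.trans (A/ρ.sym p) (A/ρ.trans r (reflexive A (b , b′) q)) , A₀.T-resp q u })
          (λ (_ , _ , u) → u)

        rep : Assembly.Carrier (cover (quotient A)) → A₀.Carrier
        rep w = proj₁ representative ⟨$⟩ w

        rep-rel : ∀ w → mem (rel A) (proj₁ w , rep w)
        rep-rel w = proj₁ (proj₂ representative w)

    open Represent using (rep-rel)

    kernel-quotient-η⁻¹ : ∀ A → QHom (kernel (quotient A)) A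
    kernel-quotient-η⁻¹ A = record
      -- The representative was required to have the code stored in w, so the identity tracks.
      { arr = trackedById (proj₁ representative) λ { {w} (lift refl) → proj₂ (proj₂ representative w) }
      ; ext = λ (w , w′) p → A/ρ.trans (A/ρ.sym (rep-rel A w)) (A/ρ.trans p (rep-rel A w′))
      }
      where open Represent A hiding (rep-rel)

    kernel-quotient : NaturalIsomorphism idF (Kernel ∘F Quotient)
    kernel-quotient = record
      { to   = record
          { η       = kernel-quotient-η
          ; commute = λ f → ext f }
      ; from = record
          { η       = kernel-quotient-η⁻¹
          -- The square commutes only up to σ: the representative of f(w) and the image of the
          -- representative of w′ are both σ-related to f applied to the point of w.
          ; commute = λ {A} {B} f (w , w′) p →
              let module B/σ = Assembly (quotient B)
                  x′ = Represent.rep A w′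
                  fw = to (arr (kernelMap (quotientMap f))) w
              in B/σ.trans (B/σ.sym (rep-rel B fw))
                   (ext f (proj₁ w , x′) (Assembly.trans (quotient A) p (rep-rel A w′))) }
      ; isoˡ = λ A (x , y) p →
          let module A/ρ = Assembly (quotient A)
          in A/ρ.trans (A/ρ.sym (rep-rel A (x , A/ρ.total x))) p
      ; isoʳ = λ A (w , w′) p →
          let module A/ρ = Assembly (quotient A)
          in A/ρ.trans (A/ρ.sym (rep-rel A w)) p
      }

    kernel-quotientD : DoctrineIsomorphism idD (KernelD ∘D QuotientD)
    kernel-quotientD = record
      { to   = record { θ = kernel-quotient.to ; lax = λ _ _ _ u → u }
      ; from = record
          { θ   = kernel-quotient.from
          -- Descent moves α from the point of w to its ρ-related representative.
          ; lax = λ A α w u → descent α (proj₁ w , Represent.rep A w) (u , rep-rel A w) }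
      ; isoˡ = kernel-quotient.isoˡ
      ; isoʳ = kernel-quotient.isoʳ
      }
      where module kernel-quotient = NaturalIsomorphism kernel-quotient

theorem4p3 : (ℓ : Level) → AxiomOfChoice ℓ →
    DoctrineEquivalence (QuotientCompletion.P̄ (PΓ {ℓ})) (Ssb {ℓ})
    × CategoryEquivalence (QuotientCompletion.Q (PΓ {ℓ})) (Asm {ℓ})
theorem4p3 ℓ choice =
    record { to = QuotientD ; from = KernelD ; unit = kernel-quotientD choice ; counit = quotient-kernelD }
  , record { to = Quotient ; from = Kernel ; unit = kernel-quotient choice ; counit = quotient-kernel }
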